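{- For all integers $n\geq 0$ we have $$H_n\big((2^{2k+2}-1)B_{2k+2}\big)=\frac{(n+1)!}{2^{n+1}}\prod_{\ell=1}^n\ell!^4.$$
   Context: The Bernoulli numbers $B_k$ are defined by $\frac{t}{e^t-1}=\sum_{k\ge 0}B_k\frac{t^k}{k!}$. For a sequence $(c_0,c_1,\ldots)$ (indexed from $k=0$), $H_n(c_k)=\det\big(c_{i+j}\big)_{0\le i,j\le n}$; here $c_k=(2^{2k+2}-1)B_{2k+2}$. $\ell!^4=(\ell!)^4$, and empty products equal $1$. -}

module Defs where

open import Data.Fin.Base using (Fin; zero; suc; toℕ; punchIn)
open import Data.Integer.Base using (+_)
import Data.Nat.Base as ℕ
open import Data.Nat.Base using (ℕ; zero; suc; _∸_; _!)
open import Data.Nat.Properties using (_!≢0)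
open import Data.Rational.Base using (ℚ; 0ℚ; 1ℚ; _+_; _*_; _-_; -_; _/_; +-*-rawSemiring; toℚᵘ)
open import Data.Rational.Properties using (+-0-commutativeMonoid; +-identityˡ; +-inverseˡ; *-identityˡ; *-identityʳ; *-zeroˡ; *-assoc; *-comm; toℚᵘ-injective; toℚᵘ-homo-*; toℚᵘ-fromℚᵘ)
import Data.Rational.Unnormalised.Base as ℚᵘ
import Data.Rational.Unnormalised.Properties as ℚᵘ
open import Data.Vec.Functional using (Vector; _∷_; []; head)
open import Relation.Binary.PropositionalEquality using (_≡_; _≗_; refl; sym; trans; cong; cong₂; module ≡-Reasoning)

open import Algebra.Definitions.RawSemiring +-*-rawSemiring using (_^_)
open import Algebra.Properties.CommutativeMonoid.Sum +-0-commutativeMonoid using (sum-syntax; sum⁺-syntax; sum-cong-≗)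

fromℕ : ℕ → ℚ
fromℕ n = + n / 1

1/_! : ℕ → ℚ
1/ k ! = (+ 1 / (k !)) {{k !≢0}}

Matrix : ℕ → Set
Matrix n = Fin n → Fin n → ℚ

-- Laplace expansion along the first row; `punchIn j` skips column j.
det : ∀ {n} → Matrix n → ℚ
det {zero}  A = 1ℚ
det {suc n} A =
  ∑[ j < suc n ] ((- 1ℚ) ^ toℕ j * A zero j * det (λ i k → A (suc i) (punchIn j k)))

hankelDet : ℕ → (ℕ → ℚ) → ℚ
hankelDet n c = det {suc n} (λ i j → c (toℕ i ℕ.+ toℕ j))

-- A formal power series Σ fₖ tᵏ is represented by its coefficients.
Series : Set
Series = ℕ → ℚ

infixl 7 _⊛_
_⊛_ : Series → Series → Series
(f ⊛ g) n = ∑[ i ≤ n ] (f (toℕ i) * g (n ∸ toℕ i))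

one : Series
one zero    = 1ℚ
one (suc _) = 0ℚ

X : Series
X 1 = 1ℚ
X _ = 0ℚ

egf : (ℕ → ℚ) → Series
egf a k = a k * 1/ k !

exp : Series
exp = egf (λ _ → 1ℚ)

exp-1 : Series
exp-1 k = exp k - one k

-- (eᵗ - 1)/t = Σ tᵏ/(k+1)!
exp-1/t : Series
exp-1/t k = exp-1 (suc k)

-- For u with constant term 1, `recip u` is the series 1/u; its coefficients
-- v satisfy vₙ₊₁ = - Σ_{i ≤ n} uᵢ₊₁ vₙ₋ᵢ.  `recips u n` lists vₙ, …, v₀.
recips : Series → (n : ℕ) → Vector ℚ (suc n)
recips u zero    = 1ℚ ∷ []
recips u (suc n) = - (∑[ i ≤ n ] (u (suc (toℕ i)) * recips u n i)) ∷ recips u n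

recip : Series → Series
recip u n = head (recips u n)

-- Σ Bₖ tᵏ/k! = t/(eᵗ - 1), so B₁ = -1/2; see `bernoulli-egf`.
bernoulli : ℕ → ℚ
bernoulli k = fromℕ (k !) * recip exp-1/t k

private
  recips-recip : ∀ u n (i : Fin (suc n)) → recips u n i ≡ recip u (n ∸ toℕ i)
  recips-recip u zero    zero    = refl
  recips-recip u (suc n) zero    = refl
  recips-recip u (suc n) (suc i) = recips-recip u n i

  recip-inverse : ∀ u → u 0 ≡ 1ℚ → u ⊛ recip u ≗ one
  recip-inverse u u₀ zero    rewrite u₀ = refl
  recip-inverse u u₀ (suc n) = begin
    u 0 * - S + ∑[ i ≤ n ] (u (suc (toℕ i)) * recip u (n ∸ toℕ i))
      ≡⟨ cong₂ _+_ (trans (cong (_* - S) u₀) (*-identityˡ (- S)))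
           (sum-cong-≗ {suc n} λ i → cong (u (suc (toℕ i)) *_) (sym (recips-recip u n i))) ⟩
    - S + S
      ≡⟨ +-inverseˡ S ⟩
    0ℚ ∎
    where
    open ≡-Reasoning
    S = ∑[ i ≤ n ] (u (suc (toℕ i)) * recips u n i)

  m*1/m : ∀ m .{{_ : ℕ.NonZero m}} → fromℕ m * (+ 1 / m) ≡ 1ℚ
  m*1/m m@(suc k) = toℚᵘ-injective (begin
    toℚᵘ (fromℕ m * (+ 1 / m))
      ≈⟨ toℚᵘ-homo-* (fromℕ m) (+ 1 / m) ⟩
    toℚᵘ (fromℕ m) ℚᵘ.* toℚᵘ (+ 1 / m)
      ≈⟨ ℚᵘ.*-cong (toℚᵘ-fromℚᵘ (ℚᵘ.mkℚᵘ (+ m) 0)) (toℚᵘ-fromℚᵘ (ℚᵘ.mkℚᵘ (+ 1) k)) ⟩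
    ℚᵘ.mkℚᵘ (+ m) 0 ℚᵘ.* ℚᵘ.mkℚᵘ (+ 1) k
      ≈⟨ ℚᵘ.*-inverseʳ (ℚᵘ.mkℚᵘ (+ m) 0) ⟩
    ℚᵘ.1ℚᵘ ∎)
    where open import Relation.Binary.Reasoning.Setoid ℚᵘ.≃-setoid

  egf-bernoulli : egf bernoulli ≗ recip exp-1/t
  egf-bernoulli k = begin
    fromℕ (k !) * v * 1/ k !    ≡⟨ cong (_* 1/ k !) (*-comm (fromℕ (k !)) v) ⟩
    v * fromℕ (k !) * 1/ k !    ≡⟨ *-assoc v (fromℕ (k !)) (1/ k !) ⟩
    v * (fromℕ (k !) * 1/ k !)  ≡⟨ cong (v *_) (m*1/m (k !) {{k !≢0}}) ⟩
    v * 1ℚ                      ≡⟨ *-identityʳ v ⟩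
    v                           ∎
    where
    open ≡-Reasoning
    v = recip exp-1/t k

-- (eᵗ - 1) · Σ Bₖ tᵏ/k! = t
bernoulli-egf : exp-1 ⊛ egf bernoulli ≗ X
bernoulli-egf zero    = refl
bernoulli-egf (suc n) = begin
  0ℚ * egf bernoulli (suc n) + ∑[ i ≤ n ] (exp-1/t (toℕ i) * egf bernoulli (n ∸ toℕ i))
    ≡⟨ cong₂ _+_ (*-zeroˡ (egf bernoulli (suc n)))
         (sum-cong-≗ {suc n} λ i → cong (exp-1/t (toℕ i) *_) (egf-bernoulli (n ∸ toℕ i))) ⟩
  0ℚ + (exp-1/t ⊛ recip exp-1/t) n  ≡⟨ +-identityˡ _ ⟩
  (exp-1/t ⊛ recip exp-1/t) n       ≡⟨ recip-inverse exp-1/t refl n ⟩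
  one n                 ≡⟨ one≗X n ⟩
  X (suc n)             ∎
  where
  open ≡-Reasoning
  one≗X : ∀ m → one m ≡ X (suc m)
  one≗X zero    = refl
  one≗X (suc _) = refl

{-# OPTIONS --safe #-}

-- Read a sequence a as the linear functional xᵐ ↦ a m. From (eᵗ - 1) Σ Bₖ tᵏ/k! = t the functional
-- xᵐ ↦ (2ᵐ - 1) Bₘ sends f(x + 1) + f(x) to -f′(0). For f a product of 2n + 2 consecutive linear factors
-- f(x + 1) + f(x) = 2 x² (x² - 1²) ⋯ (x² - n²), so with y = x² the moment functional L(yᵏ) = (2²ᵏ⁺² - 1) B₂ₖ₊₂
-- takes the value ½ (-1)ⁿ n! (n + 1)! at φₙ = (y - 1²) ⋯ (y - n²). With ρᵢ = y (y - 1²) ⋯ (y - (i - 1)²),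
-- induction on i gives L(ρᵢ φₖ) = ½ (-1)ⁱ⁺ᵏ i! (k + 1)! (i + k)!. Operations on adjacent columns carry the
-- Hankel matrix L(yⁱ yᵏ) to L(yⁱ φₖ) and then to L(yⁱ pₖ) with L(ρᵢ pₖ) = 0 for i < k; the last matrix
-- is lower triangular with diagonal L(ρₖ pₖ) = ½ (k + 1) k!⁴.

module Submission where

open import Defs

-- The series of `(2ᵐ - 1) Bₘ / m!` is -t/(eᵗ + 1), and multiplying by eᵗ is the substitution x ↦ x
-- + 1 on functionals; this is why f(x + 1) + f(x) appears. For v = (x - n - 1)(x - n) ⋯ (x + n) the
-- polynomials v(x) and v(x + 1) share all factors but one, and the two odd ones, x - n - 1 and x +
-- n + 1, add up to 2x. The derivative v′(0) is the product of the factors other than x at 0. Both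
-- bases have squares as nodes, so a factor y - i² of ρᵢ₊₁ can be traded for the factor y - (k + 1)²
-- of φₖ₊₁ at the cost of a constant. The rows are never transformed. The ρᵢ only test the columns:
-- as ρᵢ is monic of degree i, vanishing of L(ρᵢ p) for all i < k forces L(yⁱ p) = 0 for all i < k,
-- and then L(yᵏ p) = L(ρₖ p). Neighbouring columns suffice throughout, and for them the alternating
-- property follows from the expansion along the first row without any permutations.

module HankelMoments where

  open import Algebra.Bundles using (Ring)
  open import Data.Empty using (⊥-elim)
  open import Data.Fin.Base using (Fin; zero; suc; toℕ; punchIn)
  open import Data.Fin.Properties using (toℕ<n)
  import Data.Integer.Base as ℤ
  import Data.Integer.Properties as ℤ
  open import Data.List.Base using (applyUpTo; [_]; _∷ʳ_)
  open import Data.List.Properties using (applyUpTo-∷ʳ)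
  import Data.Nat.Base as ℕ
  open import Data.Nat.Base using (ℕ; zero; suc; _∸_; _<_; _≤_; z<s; s<s; z≤n; s≤s; _!)
  open import Data.Nat.Induction using (<-rec)
  open import Data.Nat.ListAction using (product)
  open import Data.Nat.ListAction.Properties using (product-++)
  import Data.Nat.Properties as ℕ
  open import Data.Nat.Properties using (_!≢0)
  open import Data.Product.Base using (_×_; _,_; proj₂; ∃-syntax)
  open import Data.Rational.Base using (ℚ; 0ℚ; 1ℚ; ½; _+_; _*_; _-_; -_; _/_; +-*-rawSemiring; toℚᵘ)
  open import Data.Rational.Properties
    using (+-0-commutativeMonoid; +-*-ring; +-identityʳ; +-inverseʳ; *-assoc; *-comm; *-identityˡ; *-identityʳ;
           *-zeroˡ; *-zeroʳ; *-distribˡ-+; toℚᵘ-injective; toℚᵘ-homo-+; toℚᵘ-homo-*; toℚᵘ-fromℚᵘ)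
  open import Data.Rational.Solver using (module +-*-Solver)
  import Data.Rational.Unnormalised.Base as ℚᵘ
  import Data.Rational.Unnormalised.Properties as ℚᵘ
  open import Data.Sum.Base using (_⊎_; inj₁; inj₂)
  open import Function.Base using (_∘_)
  open import Relation.Binary.PropositionalEquality using (_≡_; _≢_; _≗_; refl; sym; trans; cong; cong₂; module ≡-Reasoning)
  open import Relation.Nullary.Decidable using (yes; no)

  open import Algebra.Definitions.RawSemiring +-*-rawSemiring using (_^_)
  open import Algebra.Properties.CommutativeMonoid.Sum +-0-commutativeMonoid
    using (sum-syntax; sum-cong-≗; ∑-distrib-+)
  open import Algebra.Properties.Semiring.Sum (Ring.semiring +-*-ring) using (*-distribˡ-sum)
  open +-*-Solver using (solve; con; _:=_; _:+_; _:*_; _:-_; :-_)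
  open ≡-Reasoning

  shift : Series → Series
  shift a m = a (suc m)

  -- Determinants under column operations

  det-cong : ∀ {n} {M N : Matrix n} → (∀ i j → M i j ≡ N i j) → det M ≡ det N
  det-cong {zero}  e = refl
  det-cong {suc n} e = sum-cong-≗ {suc n} λ j →
    cong₂ _*_ (cong ((- 1ℚ) ^ toℕ j *_) (e zero j)) (det-cong λ i k → e (suc i) (punchIn j k))

  -- Column j of the matrix is the initial segment of the sequence A j.
  columnDet : ∀ n → (ℕ → Series) → ℚ
  columnDet n A = det {n} λ i j → A (toℕ j) (toℕ i)

  -- `punchIn` on plain numbers: with columns indexed by all of `ℕ`, a minor is again a family of
  -- sequences, and inductions on the size need no `Fin` bookkeeping.
  skip : ℕ → ℕ → ℕ
  skip zero    k       = suc k
  skip (suc j) zero    = zero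
  skip (suc j) (suc k) = suc (skip j k)

  toℕ-punchIn : ∀ {n} (j : Fin (suc n)) (k : Fin n) → toℕ (punchIn j k) ≡ skip (toℕ j) (toℕ k)
  toℕ-punchIn zero    k       = refl
  toℕ-punchIn (suc j) zero    = refl
  toℕ-punchIn (suc j) (suc k) = cong suc (toℕ-punchIn j k)

  minor : (ℕ → Series) → ℕ → ℕ → Series
  minor A j k = shift (A (skip j k))

  laplaceTerm : ℕ → (ℕ → Series) → ℕ → ℚ
  laplaceTerm n A j = (- 1ℚ) ^ j * A j 0 * columnDet n (minor A j)

  laplace : ∀ n A → columnDet (suc n) A ≡ ∑[ j < suc n ] laplaceTerm n A (toℕ j)
  laplace n A = sum-cong-≗ {suc n} λ j → cong ((- 1ℚ) ^ toℕ j * A (toℕ j) 0 *_)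
    (det-cong λ i k → cong (λ c → A c (suc (toℕ i))) (toℕ-punchIn j k))

  columnDet-cong : ∀ n {A B} → (∀ j → j < n → A j ≗ B j) → columnDet n A ≡ columnDet n B
  columnDet-cong n e = det-cong λ i j → e (toℕ j) (toℕ<n j) (toℕ i)

  skip-injective : ∀ j {k l} → skip j k ≡ skip j l → k ≡ l
  skip-injective zero    refl = refl
  skip-injective (suc j) {zero}  {zero}  _ = refl
  skip-injective (suc j) {suc k} {suc l} e = cong suc (skip-injective j (ℕ.suc-injective e))

  skip-≢ : ∀ j k → skip j k ≢ j
  skip-≢ (suc j) (suc k) e = skip-≢ j k (ℕ.suc-injective e)

  skip-adjacent-≡ : ∀ j k → k ≢ j → skip (suc j) k ≡ skip j k
  skip-adjacent-≡ zero    zero    k≢j = ⊥-elim (k≢j refl)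
  skip-adjacent-≡ zero    (suc k) k≢j = refl
  skip-adjacent-≡ (suc j) zero    k≢j = refl
  skip-adjacent-≡ (suc j) (suc k) k≢j = cong suc (skip-adjacent-≡ j k (k≢j ∘ cong suc))

  skip-diagonal : ∀ j → skip j j ≡ suc j
  skip-diagonal zero    = refl
  skip-diagonal (suc j) = cong suc (skip-diagonal j)

  skip-suc-diagonal : ∀ j → skip (suc j) j ≡ j
  skip-suc-diagonal zero    = refl
  skip-suc-diagonal (suc j) = cong suc (skip-suc-diagonal j)

  skip-surjective : ∀ {n} j k → j < suc n → k < suc n →
    j ≡ k ⊎ ∃[ l ] (skip j l ≡ k × l < n)
  skip-surjective zero    zero    _ _ = inj₁ refl
  skip-surjective zero    (suc k) _ (s<s k<n) = inj₂ (k , refl , k<n)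
  skip-surjective (suc j) zero    (s<s j<n) _ = inj₂ (0 , refl , ℕ.≤-<-trans z≤n j<n)
  skip-surjective {suc n} (suc j) (suc k) (s<s j<n) (s<s k<n) with skip-surjective j k j<n k<n
  ... | inj₁ refl             = inj₁ refl
  ... | inj₂ (l , refl , l<n) = inj₂ (suc l , refl , s<s l<n)

  -- Deleting a third column leaves two neighbouring columns neighbours, so a hypothesis on adjacent
  -- columns passes to the minors.
  skip-surjective-adjacent : ∀ {n} j k → j < suc n → suc k < suc n →
    j ≡ k ⊎ j ≡ suc k ⊎ ∃[ l ] (skip j l ≡ k × skip j (suc l) ≡ suc k × suc l < n)
  skip-surjective-adjacent zero          zero    _ _ = inj₁ refl
  skip-surjective-adjacent zero          (suc k) _ (s<s k<n) = inj₂ (inj₂ (k , refl , refl , k<n))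
  skip-surjective-adjacent (suc zero)    zero    _ _ = inj₂ (inj₁ refl)
  skip-surjective-adjacent (suc (suc j)) zero    (s<s j<n) _ =
    inj₂ (inj₂ (0 , refl , refl , ℕ.≤-<-trans (s≤s z≤n) j<n))
  skip-surjective-adjacent {suc n} (suc j) (suc k) (s<s j<n) (s<s k<n)
    with skip-surjective-adjacent j k j<n k<n
  ... | inj₁ refl                        = inj₁ refl
  ... | inj₂ (inj₁ refl)                 = inj₂ (inj₁ refl)
  ... | inj₂ (inj₂ (l , refl , e , l<n)) = inj₂ (inj₂ (suc l , refl , cong suc e , s<s l<n))

  columnDet-linear : ∀ n k x {A B C} → k < n →
    (∀ i → A k i ≡ B k i + x * C k i) →
    (∀ j → j ≢ k → A j ≗ B j) → (∀ j → j ≢ k → A j ≗ C j) →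
    columnDet n A ≡ columnDet n B + x * columnDet n C
  columnDet-linear (suc n) k x {A} {B} {C} k<n Aₖ A≗B A≗C = begin
    columnDet (suc n) A
      ≡⟨ laplace n A ⟩
    ∑[ j < suc n ] laplaceTerm n A (toℕ j)
      ≡⟨ sum-cong-≗ {suc n} (λ j → term (toℕ j) (toℕ<n j)) ⟩
    ∑[ j < suc n ] (laplaceTerm n B (toℕ j) + x * laplaceTerm n C (toℕ j))
      ≡⟨ ∑-distrib-+ {suc n} (laplaceTerm n B ∘ toℕ) (λ j → x * laplaceTerm n C (toℕ j)) ⟩
    ∑[ j < suc n ] laplaceTerm n B (toℕ j) + ∑[ j < suc n ] (x * laplaceTerm n C (toℕ j))
      ≡⟨ cong₂ _+_ (sym (laplace n B))
           (trans (sym (*-distribˡ-sum {suc n} x (laplaceTerm n C ∘ toℕ))) (cong (x *_) (sym (laplace n C)))) ⟩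
    columnDet (suc n) B + x * columnDet (suc n) C ∎
    where
    term : ∀ j → j < suc n → laplaceTerm n A j ≡ laplaceTerm n B j + x * laplaceTerm n C j
    term j j<n with skip-surjective j k j<n k<n
    ... | inj₁ refl = begin
      s * A j 0 * columnDet n (minor A j)
        ≡⟨ cong₂ (λ a d → s * a * d) (Aₖ 0) (columnDet-cong n λ l _ i → A≗C (skip j l) (skip-≢ j l) (suc i)) ⟩
      s * (B j 0 + x * C j 0) * d
        ≡⟨ solve 5 (λ s b x c d → s :* (b :+ x :* c) :* d := s :* b :* d :+ x :* (s :* c :* d)) refl s (B j 0) x (C j 0) d ⟩
      s * B j 0 * d + x * (s * C j 0 * d)
        ≡⟨ cong (λ e → s * B j 0 * e + x * (s * C j 0 * d))
             (columnDet-cong n λ l _ i → trans (sym (A≗C (skip j l) (skip-≢ j l) (suc i))) (A≗B (skip j l) (skip-≢ j l) (suc i))) ⟩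
      s * B j 0 * columnDet n (minor B j) + x * (s * C j 0 * d) ∎
      where
      s = (- 1ℚ) ^ j
      d = columnDet n (minor C j)
    -- The changed column survives in the minor at position `l`, so the linearity comes from the
    -- induction.
    ... | inj₂ (l , refl , l<n) = begin
      s * A j 0 * columnDet n (minor A j)
        ≡⟨ cong (s * A j 0 *_) (columnDet-linear n l x l<n (Aₖ ∘ suc)
             (λ m m≢l → A≗B (skip j m) (m≢l ∘ skip-injective j) ∘ suc)
             (λ m m≢l → A≗C (skip j m) (m≢l ∘ skip-injective j) ∘ suc)) ⟩
      s * A j 0 * (b + x * c)
        ≡⟨ solve 5 (λ s a b x c → s :* a :* (b :+ x :* c) := s :* a :* b :+ x :* (s :* a :* c)) refl s (A j 0) b x c ⟩
      s * A j 0 * b + x * (s * A j 0 * c)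
        ≡⟨ cong₂ (λ u v → s * u * b + x * (s * v * c)) (A≗B j j≢k 0) (A≗C j j≢k 0) ⟩
      s * B j 0 * b + x * (s * C j 0 * c) ∎
      where
      s = (- 1ℚ) ^ j
      b = columnDet n (minor B j)
      c = columnDet n (minor C j)
      j≢k : j ≢ skip j l
      j≢k e = skip-≢ j l (sym e)

  ∑-zero : ∀ n (f : ℕ → ℚ) → (∀ j → j < n → f j ≡ 0ℚ) → ∑[ j < n ] f (toℕ j) ≡ 0ℚ
  ∑-zero zero    f f≡0 = refl
  ∑-zero (suc n) f f≡0 = cong₂ _+_ (f≡0 0 z<s) (∑-zero n (f ∘ suc) λ j → f≡0 (suc j) ∘ s<s)

  ∑-cancelling-pair : ∀ n k (f : ℕ → ℚ) → suc k < n → f k + f (suc k) ≡ 0ℚ →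
    (∀ j → j < n → j ≢ k → j ≢ suc k → f j ≡ 0ℚ) → ∑[ j < n ] f (toℕ j) ≡ 0ℚ
  ∑-cancelling-pair (suc (suc n)) zero f _ f₀+f₁ f≡0 = begin
    f 0 + (f 1 + ∑[ j < n ] f (suc (suc (toℕ j))))
      ≡⟨ cong (λ s → f 0 + (f 1 + s)) (∑-zero n (λ j → f (suc (suc j))) λ j j<n → f≡0 (suc (suc j)) (s<s (s<s j<n)) (λ ()) (λ ())) ⟩
    f 0 + (f 1 + 0ℚ)
      ≡⟨ cong (f 0 +_) (+-identityʳ (f 1)) ⟩
    f 0 + f 1
      ≡⟨ f₀+f₁ ⟩
    0ℚ ∎
  ∑-cancelling-pair (suc n) (suc k) f (s<s k<n) pair f≡0 =
    cong₂ _+_ (f≡0 0 z<s (λ ()) (λ ()))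
      (∑-cancelling-pair n k (f ∘ suc) k<n pair λ j j<n j≢k j≢1+k →
        f≡0 (suc j) (s<s j<n) (j≢k ∘ ℕ.suc-injective) (j≢1+k ∘ ℕ.suc-injective))

  -- Expanding at either of the two equal columns gives the same minor with opposite signs; every
  -- other minor still contains both as neighbours and vanishes by induction. For columns further
  -- apart the two minors would differ by a permutation.
  columnDet-adjacent-≡ : ∀ n k {A} → suc k < n → A k ≗ A (suc k) → columnDet n A ≡ 0ℚ
  columnDet-adjacent-≡ (suc n) k {A} k<n eq =
    trans (laplace n A) (∑-cancelling-pair (suc n) k (laplaceTerm n A) k<n pair others)
    where
    minors : ∀ m → minor A k m ≗ minor A (suc k) m
    minors m i with m ℕ.≟ k
    ... | no  m≢k  = cong (λ c → A c (suc i)) (sym (skip-adjacent-≡ k m m≢k))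
    ... | yes refl = begin
      A (skip k k) (suc i)        ≡⟨ cong (λ c → A c (suc i)) (skip-diagonal k) ⟩
      A (suc k) (suc i)           ≡⟨ eq (suc i) ⟨
      A k (suc i)                 ≡⟨ cong (λ c → A c (suc i)) (skip-suc-diagonal k) ⟨
      A (skip (suc k) k) (suc i)  ∎
    pair : laplaceTerm n A k + laplaceTerm n A (suc k) ≡ 0ℚ
    pair = begin
      s * A k 0 * columnDet n (minor A k) + - 1ℚ * s * A (suc k) 0 * d
        ≡⟨ cong₂ (λ a e → s * a * e + - 1ℚ * s * A (suc k) 0 * d) (eq 0) (columnDet-cong n λ m _ → minors m) ⟩
      s * a * d + - 1ℚ * s * a * d
        ≡⟨ solve 3 (λ s a d → s :* a :* d :+ con (- 1ℚ) :* s :* a :* d := con 0ℚ) refl s a d ⟩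
      0ℚ ∎
      where
      s = (- 1ℚ) ^ k
      a = A (suc k) 0
      d = columnDet n (minor A (suc k))
    others : ∀ j → j < suc n → j ≢ k → j ≢ suc k → laplaceTerm n A j ≡ 0ℚ
    others j j<n j≢k j≢1+k with skip-surjective-adjacent j k j<n k<n
    ... | inj₁ j≡k          = ⊥-elim (j≢k j≡k)
    ... | inj₂ (inj₁ j≡1+k) = ⊥-elim (j≢1+k j≡1+k)
    ... | inj₂ (inj₂ (l , refl , e , l<n)) = trans
      (cong ((- 1ℚ) ^ j * A j 0 *_) (columnDet-adjacent-≡ n l l<n λ i →
        trans (eq (suc i)) (cong (λ c → A c (suc i)) (sym e))))
      (*-zeroʳ ((- 1ℚ) ^ j * A j 0))

  replace : ℕ → Series → (ℕ → Series) → ℕ → Series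
  replace zero    v A zero    = v
  replace zero    v A (suc c) = A (suc c)
  replace (suc k) v A zero    = A zero
  replace (suc k) v A (suc c) = replace k v (A ∘ suc) c

  replace-≡ : ∀ k v A → replace k v A k ≡ v
  replace-≡ zero    v A = refl
  replace-≡ (suc k) v A = replace-≡ k v (A ∘ suc)

  replace-≢ : ∀ k v A c → c ≢ k → replace k v A c ≡ A c
  replace-≢ zero    v A zero    c≢k = ⊥-elim (c≢k refl)
  replace-≢ zero    v A (suc c) c≢k = refl
  replace-≢ (suc k) v A zero    c≢k = refl
  replace-≢ (suc k) v A (suc c) c≢k = replace-≢ k v (A ∘ suc) c (c≢k ∘ cong suc)

  columnDet-addAdjacent : ∀ n k x {A B} → suc k < n →
    (∀ i → B (suc k) i ≡ A (suc k) i + x * A k i) →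
    (∀ j → j ≢ suc k → B j ≗ A j) → columnDet n B ≡ columnDet n A
  columnDet-addAdjacent n k x {A} {B} k<n B₁₊ₖ B≗A = begin
    columnDet n B
      ≡⟨ columnDet-linear n (suc k) x k<n
           (λ i → trans (B₁₊ₖ i) (cong (λ v → A (suc k) i + x * v i) (sym (replace-≡ (suc k) (A k) A))))
           B≗A (λ j j≢ i → trans (B≗A j j≢ i) (cong (λ v → v i) (sym (replace-≢ (suc k) (A k) A j j≢)))) ⟩
    columnDet n A + x * columnDet n A′
      ≡⟨ cong (λ d → columnDet n A + x * d) (columnDet-adjacent-≡ n k {A′} k<n λ i → cong (λ v → v i)
           (trans (replace-≢ (suc k) (A k) A k (ℕ.1+n≢n ∘ sym)) (sym (replace-≡ (suc k) (A k) A)))) ⟩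
    columnDet n A + x * 0ℚ
      ≡⟨ solve 2 (λ a x → a :+ x :* con 0ℚ := a) refl (columnDet n A) x ⟩
    columnDet n A ∎
    where A′ = replace (suc k) (A k) A

  -- Elimination between neighbouring columns

  hybrid : ℕ → (A B : ℕ → Series) → ℕ → Series
  hybrid zero    A B c       = B c
  hybrid (suc s) A B zero    = A zero
  hybrid (suc s) A B (suc c) = hybrid s (A ∘ suc) (B ∘ suc) c

  hybrid-< : ∀ s A B {c} → c < s → hybrid s A B c ≡ A c
  hybrid-< (suc s) A B {zero}  _         = refl
  hybrid-< (suc s) A B {suc c} (s<s c<s) = hybrid-< s (A ∘ suc) (B ∘ suc) c<s

  hybrid-≡ : ∀ s A B → hybrid s A B s ≡ B s
  hybrid-≡ zero    A B = refl
  hybrid-≡ (suc s) A B = hybrid-≡ s (A ∘ suc) (B ∘ suc)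

  hybrid-suc-≢ : ∀ s A B c → c ≢ s → hybrid (suc s) A B c ≡ hybrid s A B c
  hybrid-suc-≢ zero    A B zero    c≢s = ⊥-elim (c≢s refl)
  hybrid-suc-≢ zero    A B (suc c) c≢s = refl
  hybrid-suc-≢ (suc s) A B zero    c≢s = refl
  hybrid-suc-≢ (suc s) A B (suc c) c≢s = hybrid-suc-≢ s (A ∘ suc) (B ∘ suc) c (c≢s ∘ cong suc)

  -- The columns are changed one at a time from the right, so that each is still
  -- next to its unchanged left neighbour.
  columnDet-shear : ∀ n (t : ℕ → ℚ) A B → B 0 ≗ A 0 →
    (∀ k i → B (suc k) i ≡ A (suc k) i + t k * A k i) → columnDet n B ≡ columnDet n A
  columnDet-shear n t A B B₀ B₁₊ = sym (trans
    (columnDet-cong n λ c c<n i → cong (λ v → v i) (sym (hybrid-< n A B c<n))) (steps n ℕ.≤-refl))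
    where
    steps : ∀ s → s ≤ n → columnDet n (hybrid s A B) ≡ columnDet n B
    steps zero          _   = refl
    -- Column `0` has no left neighbour; there both families agree by `B₀`.
    steps (suc zero)    _   = columnDet-cong n {hybrid 1 A B} {B} λ { zero _ i → sym (B₀ i) ; (suc c) _ i → refl }
    steps (suc (suc s)) s<n = trans
      (sym (columnDet-addAdjacent n s (t s) s<n changed
        λ j j≢ i → cong (λ v → v i) (sym (hybrid-suc-≢ (suc s) A B j j≢))))
      (steps (suc s) (ℕ.<⇒≤ s<n))
      where
      changed : ∀ i → hybrid (suc s) A B (suc s) i
                    ≡ hybrid (suc (suc s)) A B (suc s) i + t s * hybrid (suc (suc s)) A B s i
      changed i
        rewrite hybrid-≡ (suc s) A B
              | hybrid-< (suc (suc s)) A B (ℕ.≤-refl {suc (suc s)})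
              | hybrid-< (suc (suc s)) A B (ℕ.m<n⇒m<1+n (ℕ.≤-refl {suc s}))
        = B₁₊ s i

  -- Columns after s elimination steps on the array G: G 0 0, …, G (s-1) 0, G s 0, G s 1, ….
  staircase : ℕ → (ℕ → ℕ → Series) → ℕ → Series
  staircase zero    G k       = G 0 k
  staircase (suc s) G zero    = G 0 0
  staircase (suc s) G (suc k) = staircase s (G ∘ suc) k

  staircase-diagonal : ∀ s G k → k < s → staircase s G k ≡ G k 0
  staircase-diagonal (suc s) G zero    _         = refl
  staircase-diagonal (suc s) G (suc k) (s<s k<s) = staircase-diagonal s (G ∘ suc) k k<s

  -- The value `0ℚ` below position `s` leaves the finished columns alone, so every stage is a shear
  -- of the whole matrix.
  staircase-coefficient : ℕ → (ℕ → ℕ → ℚ) → ℕ → ℚ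
  staircase-coefficient zero    t k       = t 0 k
  staircase-coefficient (suc s) t zero    = 0ℚ
  staircase-coefficient (suc s) t (suc k) = staircase-coefficient s (t ∘ suc) k

  -- The triangular scheme of Neville elimination: each entry of a stage comes from two neighbours
  -- of the stage before.
  IsElimination : (ℕ → ℕ → ℚ) → (ℕ → ℕ → Series) → Set
  IsElimination t G = ∀ s m i → G (suc s) m i ≡ G s (suc m) i + t s m * G s m i

  staircase-zero : ∀ s G → staircase (suc s) G 0 ≗ staircase s G 0
  staircase-zero zero    G i = refl
  staircase-zero (suc s) G i = refl

  staircase-suc : ∀ s t G → IsElimination t G → ∀ k i →
    staircase (suc s) G (suc k) i
      ≡ staircase s G (suc k) i + staircase-coefficient s t k * staircase s G k i
  staircase-suc zero    t G elim k       i = elim 0 k i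
  staircase-suc (suc s) t G elim zero    i = trans (staircase-zero s (G ∘ suc) i)
    (solve 2 (λ a b → a := a :+ con 0ℚ :* b) refl (staircase s (G ∘ suc) 0 i) (G 0 0 i))
  staircase-suc (suc s) t G elim (suc k) i = staircase-suc s (t ∘ suc) (G ∘ suc) (elim ∘ suc) k i

  -- Each stage is one shear, and column `k` is final after `k` stages, when it has become `G k 0`.
  columnDet-elimination : ∀ n t G → IsElimination t G → columnDet n (G 0) ≡ columnDet n (λ k → G k 0)
  columnDet-elimination n t G elim = trans (sym (steps n))
    (columnDet-cong n λ k k<n i → cong (λ v → v i) (staircase-diagonal n G k k<n))
    where
    steps : ∀ s → columnDet n (staircase s G) ≡ columnDet n (G 0)
    steps zero    = refl
    steps (suc s) = trans
      (columnDet-shear n (staircase-coefficient s t) (staircase s G) (staircase (suc s) G)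
        (staircase-zero s G) (staircase-suc s t G elim))
      (steps s)

  ∏< : ℕ → (ℕ → ℚ) → ℚ
  ∏< zero    f = 1ℚ
  ∏< (suc n) f = f 0 * ∏< n (f ∘ suc)

  columnDet-triangular : ∀ n A → (∀ k i → i < k → A k i ≡ 0ℚ) → columnDet n A ≡ ∏< n (λ k → A k k)
  columnDet-triangular zero    A upper = refl
  columnDet-triangular (suc n) A upper = begin
    columnDet (suc n) A
      ≡⟨ laplace n A ⟩
    1ℚ * A 0 0 * d + ∑[ j < n ] laplaceTerm n A (suc (toℕ j))
      ≡⟨ cong (1ℚ * A 0 0 * d +_) (∑-zero n (laplaceTerm n A ∘ suc) λ j _ → trans
           (cong (λ a → (- 1ℚ) ^ suc j * a * columnDet n (minor A (suc j))) (upper (suc j) 0 z<s))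
           (solve 2 (λ s d → s :* con 0ℚ :* d := con 0ℚ) refl ((- 1ℚ) ^ suc j) (columnDet n (minor A (suc j))))) ⟩
    1ℚ * A 0 0 * d + 0ℚ
      ≡⟨ solve 2 (λ a d → con 1ℚ :* a :* d :+ con 0ℚ := a :* d) refl (A 0 0) d ⟩
    A 0 0 * d
      ≡⟨ cong (A 0 0 *_) (columnDet-triangular n (minor A 0) λ k i i<k → upper (suc k) (suc i) (s<s i<k)) ⟩
    A 0 0 * ∏< n (λ k → A (suc k) (suc k)) ∎
    where d = columnDet n (minor A 0)

  -- Bernoulli numbers as linear functionals

  /-fromℕ : ∀ m d .{{_ : ℕ.NonZero d}} → (ℤ.+ m / d) * fromℕ d ≡ fromℕ m
  /-fromℕ m d@(suc k) = toℚᵘ-injective (R.begin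
    toℚᵘ ((ℤ.+ m / d) * fromℕ d)               R.≈⟨ toℚᵘ-homo-* (ℤ.+ m / d) (fromℕ d) ⟩
    toℚᵘ (ℤ.+ m / d) ℚᵘ.* toℚᵘ (fromℕ d)       R.≈⟨ ℚᵘ.*-cong (toℚᵘ-fromℚᵘ (ℚᵘ.mkℚᵘ (ℤ.+ m) k)) (toℚᵘ-fromℚᵘ (ℚᵘ.mkℚᵘ (ℤ.+ d) 0)) ⟩
    ℚᵘ.mkℚᵘ (ℤ.+ m) k ℚᵘ.* ℚᵘ.mkℚᵘ (ℤ.+ d) 0     R.≈⟨ ℚᵘ.*≡* (ℤ.*-assoc (ℤ.+ m) (ℤ.+ d) (ℤ.+ 1)) ⟩
    ℚᵘ.mkℚᵘ (ℤ.+ m) 0                           R.≈⟨ toℚᵘ-fromℚᵘ (ℚᵘ.mkℚᵘ (ℤ.+ m) 0) ⟨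
    toℚᵘ (fromℕ m) R.∎)
    where import Relation.Binary.Reasoning.Setoid ℚᵘ.≃-setoid as R

  fromℕ-+ : ∀ m n → fromℕ (m ℕ.+ n) ≡ fromℕ m + fromℕ n
  fromℕ-+ m n = toℚᵘ-injective (R.begin
    toℚᵘ (fromℕ (m ℕ.+ n))                     R.≈⟨ toℚᵘ-fromℚᵘ (ℚᵘ.mkℚᵘ (ℤ.+ (m ℕ.+ n)) 0) ⟩
    ℚᵘ.mkℚᵘ (ℤ.+ (m ℕ.+ n)) 0                    R.≈⟨ ℚᵘ.*≡* (cong (ℤ._* ℤ.+ 1) (sym (cong₂ ℤ._+_ (ℤ.*-identityʳ (ℤ.+ m)) (ℤ.*-identityʳ (ℤ.+ n))))) ⟩
    ℚᵘ.mkℚᵘ (ℤ.+ m) 0 ℚᵘ.+ ℚᵘ.mkℚᵘ (ℤ.+ n) 0       R.≈⟨ ℚᵘ.+-cong (toℚᵘ-fromℚᵘ (ℚᵘ.mkℚᵘ (ℤ.+ m) 0)) (toℚᵘ-fromℚᵘ (ℚᵘ.mkℚᵘ (ℤ.+ n) 0)) ⟨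
    toℚᵘ (fromℕ m) ℚᵘ.+ toℚᵘ (fromℕ n)         R.≈⟨ toℚᵘ-homo-+ (fromℕ m) (fromℕ n) ⟨
    toℚᵘ (fromℕ m + fromℕ n) R.∎)
    where import Relation.Binary.Reasoning.Setoid ℚᵘ.≃-setoid as R

  fromℕ-suc : ∀ n → fromℕ (suc n) ≡ 1ℚ + fromℕ n
  fromℕ-suc = fromℕ-+ 1

  fromℕ-* : ∀ m n → fromℕ (m ℕ.* n) ≡ fromℕ m * fromℕ n
  fromℕ-* zero    n = sym (*-zeroˡ (fromℕ n))
  fromℕ-* (suc m) n = begin
    fromℕ (n ℕ.+ m ℕ.* n)          ≡⟨ fromℕ-+ n (m ℕ.* n) ⟩
    fromℕ n + fromℕ (m ℕ.* n)      ≡⟨ cong (λ p → fromℕ n + p) (fromℕ-* m n) ⟩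
    fromℕ n + fromℕ m * fromℕ n    ≡⟨ solve 2 (λ m n → n :+ m :* n := (con 1ℚ :+ m) :* n) refl (fromℕ m) (fromℕ n) ⟩
    (1ℚ + fromℕ m) * fromℕ n       ≡⟨ cong (_* fromℕ n) (fromℕ-suc m) ⟨
    fromℕ (suc m) * fromℕ n ∎

  fromℕ-*-cancelˡ : ∀ d .{{_ : ℕ.NonZero d}} {p q} → fromℕ d * p ≡ fromℕ d * q → p ≡ q
  fromℕ-*-cancelˡ d {p} {q} eq = begin
    p                          ≡⟨ undo p ⟨
    (ℤ.+ 1 / d) * (fromℕ d * p)  ≡⟨ cong (ℤ.+ 1 / d *_) eq ⟩
    (ℤ.+ 1 / d) * (fromℕ d * q)  ≡⟨ undo q ⟩
    q                          ∎
    where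
    undo : ∀ r → (ℤ.+ 1 / d) * (fromℕ d * r) ≡ r
    undo r = trans (sym (*-assoc (ℤ.+ 1 / d) (fromℕ d) r))
      (trans (cong (_* r) (/-fromℕ 1 d)) (*-identityˡ r))

  -- A sequence a also stands for the linear functional xᵐ ↦ a m on polynomials;
  -- translate a is then f(x) ↦ a(f(x + 1)).
  translate : Series → Series
  translate a zero    = a zero
  translate a (suc m) = translate (λ k → shift a k + a k) m

  translate-cong : ∀ {a b} → a ≗ b → translate a ≗ translate b
  translate-cong e zero    = e zero
  translate-cong e (suc m) = translate-cong (λ k → cong₂ _+_ (e (suc k)) (e k)) m

  translate-linear : ∀ r a b m → translate (λ k → a k + r * b k) m ≡ translate a m + r * translate b m
  translate-linear r a b zero    = refl
  translate-linear r a b (suc m) = trans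
    (translate-cong (λ k → solve 5 (λ r a a′ b b′ → (a′ :+ r :* b′) :+ (a :+ r :* b) := (a′ :+ a) :+ r :* (b′ :+ b))
      refl r (a k) (a (suc k)) (b k) (b (suc k))) m)
    (translate-linear r (λ k → shift a k + a k) (λ k → shift b k + b k) m)

  ⊛-linearʳ : ∀ f {g h l} r → (∀ k → g k ≡ h k + r * l k) → ∀ m → (f ⊛ g) m ≡ (f ⊛ h) m + r * (f ⊛ l) m
  ⊛-linearʳ f {g} {h} {l} r e zero = trans (cong (λ x → f 0 * x + 0ℚ) (e 0))
    (solve 4 (λ f h r l → f :* (h :+ r :* l) :+ con 0ℚ := f :* h :+ con 0ℚ :+ r :* (f :* l :+ con 0ℚ)) refl (f 0) (h 0) r (l 0))
  ⊛-linearʳ f {g} {h} {l} r e (suc m) = trans (cong₂ (λ x y → f 0 * x + y) (e (suc m)) (⊛-linearʳ (shift f) {g} {h} {l} r e m))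
    (solve 6 (λ f h r l a b → f :* (h :+ r :* l) :+ (a :+ r :* b) := f :* h :+ a :+ r :* (f :* l :+ b)) refl
      (f 0) (h (suc m)) r (l (suc m)) ((shift f ⊛ h) m) ((shift f ⊛ l) m))

  derivative : Series → Series
  derivative f m = fromℕ (suc m) * f (suc m)

  ⊛-linearˡ : ∀ {f h l} g r → (∀ k → f k ≡ h k + r * l k) → ∀ m → (f ⊛ g) m ≡ (h ⊛ g) m + r * (l ⊛ g) m
  ⊛-linearˡ {f} {h} {l} g r e zero = trans (cong (λ x → x * g 0 + 0ℚ) (e 0))
    (solve 4 (λ g h r l → (h :+ r :* l) :* g :+ con 0ℚ := h :* g :+ con 0ℚ :+ r :* (l :* g :+ con 0ℚ)) refl (g 0) (h 0) r (l 0))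
  ⊛-linearˡ {f} {h} {l} g r e (suc m) = trans
    (cong₂ (λ x y → x * g (suc m) + y) (e 0) (⊛-linearˡ {shift f} {shift h} {shift l} g r (λ k → e (suc k)) m))
    (solve 6 (λ g h r l a b → (h :+ r :* l) :* g :+ (a :+ r :* b) := h :* g :+ a :+ r :* (l :* g :+ b)) refl
      (g (suc m)) (h 0) r (l 0) ((shift h ⊛ g) m) ((shift l ⊛ g) m))

  -- The product rule stands in for binomial coefficients when a product with `exp` is compared with
  -- `translate`.
  leibniz : ∀ f g m → fromℕ (suc m) * (f ⊛ g) (suc m) ≡ (derivative f ⊛ g) m + (f ⊛ derivative g) m
  leibniz f g zero = solve 4 (λ f f′ g g′ →
    con 1ℚ :* (f :* g′ :+ (f′ :* g :+ con 0ℚ)) := con 1ℚ :* f′ :* g :+ con 0ℚ :+ (f :* (con 1ℚ :* g′) :+ con 0ℚ))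
    refl (f 0) (f 1) (g 0) (g 1)
  leibniz f g (suc m) = begin
    N * (f 0 * g (suc (suc m)) + p)
      ≡⟨ cong (_* (f 0 * g (suc (suc m)) + p)) (fromℕ-suc (suc m)) ⟩
    (1ℚ + n) * (f 0 * g (suc (suc m)) + p)
      ≡⟨ solve 4 (λ n f g p → (con 1ℚ :+ n) :* (f :* g :+ p) := f :* ((con 1ℚ :+ n) :* g) :+ p :+ n :* p) refl
           n (f 0) (g (suc (suc m))) p ⟩
    f 0 * ((1ℚ + n) * g (suc (suc m))) + p + n * p
      ≡⟨ cong₂ (λ k s → f 0 * (k * g (suc (suc m))) + p + s) (sym (fromℕ-suc (suc m))) (leibniz (shift f) g m) ⟩
    f 0 * g′ + (f 1 * g (suc m) + q) + (r + s)
      ≡⟨ solve 7 (λ f f′ g g′ q r s → f :* g′ :+ (f′ :* g :+ q) :+ (r :+ s) := con 1ℚ :* f′ :* g :+ (r :+ con 1ℚ :* q) :+ (f :* g′ :+ s))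
           refl (f 0) (f 1) (g (suc m)) g′ q r s ⟩
    1ℚ * f 1 * g (suc m) + (r + 1ℚ * q) + (f 0 * g′ + s)
      ≡⟨ cong (λ z → 1ℚ * f 1 * g (suc m) + z + (f 0 * g′ + s))
           (⊛-linearˡ {shift (derivative f)} {derivative (shift f)} {shift (shift f)} g 1ℚ shift-derivative m) ⟨
    1ℚ * f 1 * g (suc m) + (shift (derivative f) ⊛ g) m + (f 0 * g′ + s) ∎
    where
    N = fromℕ (suc (suc m))
    n = fromℕ (suc m)
    p = (shift f ⊛ g) (suc m)
    q = (shift (shift f) ⊛ g) m
    r = (derivative (shift f) ⊛ g) m
    s = (shift f ⊛ derivative g) m
    g′ = derivative g (suc m)
    shift-derivative : ∀ k → shift (derivative f) k ≡ derivative (shift f) k + 1ℚ * shift (shift f) k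
    shift-derivative k = trans (cong (_* f (suc (suc k))) (fromℕ-suc (suc k)))
      (solve 2 (λ n f → (con 1ℚ :+ n) :* f := n :* f :+ con 1ℚ :* f) refl (fromℕ (suc k)) (f (suc (suc k))))

  factorial-inverseʳ : ∀ k → fromℕ (k !) * 1/ k ! ≡ 1ℚ
  factorial-inverseʳ k = trans (*-comm (fromℕ (k !)) (1/ k !)) (/-fromℕ 1 (k !) {{k !≢0}})

  suc*1/suc! : ∀ k → fromℕ (suc k) * 1/ suc k ! ≡ 1/ k !
  suc*1/suc! k = fromℕ-*-cancelˡ (k !) {{k !≢0}} (begin
    fromℕ (k !) * (fromℕ (suc k) * 1/ suc k !)
      ≡⟨ solve 3 (λ a b c → a :* (b :* c) := b :* a :* c) refl (fromℕ (k !)) (fromℕ (suc k)) (1/ suc k !) ⟩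
    fromℕ (suc k) * fromℕ (k !) * 1/ suc k !
      ≡⟨ cong (_* 1/ suc k !) (fromℕ-* (suc k) (k !)) ⟨
    fromℕ (suc k !) * 1/ suc k !
      ≡⟨ factorial-inverseʳ (suc k) ⟩
    1ℚ
      ≡⟨ factorial-inverseʳ k ⟨
    fromℕ (k !) * 1/ k ! ∎)

  derivative-egf : ∀ a → derivative (egf a) ≗ egf (shift a)
  derivative-egf a k = begin
    fromℕ (suc k) * (a (suc k) * 1/ suc k !)
      ≡⟨ solve 3 (λ a b c → a :* (b :* c) := b :* (a :* c)) refl (fromℕ (suc k)) (a (suc k)) (1/ suc k !) ⟩
    a (suc k) * (fromℕ (suc k) * 1/ suc k !)
      ≡⟨ cong (a (suc k) *_) (suc*1/suc! k) ⟩
    a (suc k) * 1/ k ! ∎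

  ⊛-cong : ∀ {f f′ g g′} → f ≗ f′ → g ≗ g′ → f ⊛ g ≗ f′ ⊛ g′
  ⊛-cong e e′ m = sum-cong-≗ {suc m} λ i → cong₂ _*_ (e (toℕ i)) (e′ (m ∸ toℕ i))

  -- The rule (eᵗ A)′ = eᵗ (A′ + A) is the recursion that defines `translate`, since differentiating
  -- an exponential generating function shifts its sequence.
  exp-⊛-egf : ∀ a → exp ⊛ egf a ≗ egf (translate a)
  exp-⊛-egf a zero    = solve 1 (λ a → con 1ℚ :* con 1ℚ :* (a :* con 1ℚ) :+ con 0ℚ := a :* con 1ℚ) refl (a 0)
  exp-⊛-egf a (suc m) = fromℕ-*-cancelˡ (suc m) (begin
    fromℕ (suc m) * (exp ⊛ egf a) (suc m)
      ≡⟨ leibniz exp (egf a) m ⟩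
    (derivative exp ⊛ egf a) m + (exp ⊛ derivative (egf a)) m
      ≡⟨ cong₂ _+_ (⊛-cong {g = egf a} (derivative-egf (λ _ → 1ℚ)) (λ _ → refl) m)
           (⊛-cong {f = exp} (λ _ → refl) (derivative-egf a) m) ⟩
    (exp ⊛ egf a) m + (exp ⊛ egf (shift a)) m
      ≡⟨ solve 2 (λ x y → x :+ y := y :+ con 1ℚ :* x) refl ((exp ⊛ egf a) m) ((exp ⊛ egf (shift a)) m) ⟩
    (exp ⊛ egf (shift a)) m + 1ℚ * (exp ⊛ egf a) m
      ≡⟨ ⊛-linearʳ exp {egf (λ k → shift a k + a k)} {egf (shift a)} {egf a} 1ℚ (λ k →
           solve 3 (λ a a′ f → (a′ :+ a) :* f := a′ :* f :+ con 1ℚ :* (a :* f)) refl (a k) (a (suc k)) (1/ k !)) m ⟨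
    (exp ⊛ egf (λ k → shift a k + a k)) m
      ≡⟨ exp-⊛-egf (λ k → shift a k + a k) m ⟩
    egf (translate (λ k → shift a k + a k)) m
      ≡⟨ derivative-egf (translate a) m ⟨
    fromℕ (suc m) * egf (translate a) (suc m) ∎)

  one-⊛ : ∀ g → one ⊛ g ≗ g
  one-⊛ g zero    = solve 1 (λ g → con 1ℚ :* g :+ con 0ℚ := g) refl (g 0)
  one-⊛ g (suc m) = begin
    1ℚ * g (suc m) + (shift one ⊛ g) m
      ≡⟨ cong (1ℚ * g (suc m) +_) (zero-⊛ m) ⟩
    1ℚ * g (suc m) + 0ℚ
      ≡⟨ solve 1 (λ g → con 1ℚ :* g :+ con 0ℚ := g) refl (g (suc m)) ⟩
    g (suc m) ∎
    where
    zero-⊛ : ∀ k → ((λ _ → 0ℚ) ⊛ g) k ≡ 0ℚ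
    zero-⊛ zero    = solve 1 (λ x → con 0ℚ :* x :+ con 0ℚ := con 0ℚ) refl (g 0)
    zero-⊛ (suc k) = cong₂ _+_ (*-zeroˡ (g (suc k))) (zero-⊛ k)

  -- This is (eᵗ - 1) Σ Bₖ tᵏ/k! = t read as a statement on functionals; `X` is f ↦ f′(0).
  translate-bernoulli : ∀ m → translate bernoulli m ≡ bernoulli m + X m
  translate-bernoulli m = begin
    translate bernoulli m
      ≡⟨ solve 2 (λ a b → a := b :+ (a :- b)) refl (translate bernoulli m) (bernoulli m) ⟩
    bernoulli m + (translate bernoulli m - bernoulli m)
      ≡⟨ cong (bernoulli m +_) (begin
        translate bernoulli m - bernoulli m
          ≡⟨ *-identityˡ _ ⟨
        1ℚ * (translate bernoulli m - bernoulli m)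
          ≡⟨ cong (_* (translate bernoulli m - bernoulli m)) (factorial-inverseʳ m) ⟨
        fromℕ (m !) * 1/ m ! * (translate bernoulli m - bernoulli m)
          ≡⟨ solve 4 (λ n f t b → n :* f :* (t :- b) := n :* (t :* f :+ con (- 1ℚ) :* (b :* f))) refl
               (fromℕ (m !)) (1/ m !) (translate bernoulli m) (bernoulli m) ⟩
        fromℕ (m !) * (egf (translate bernoulli) m + - 1ℚ * egf bernoulli m)
          ≡⟨ cong (fromℕ (m !) *_) (begin
            egf (translate bernoulli) m + - 1ℚ * egf bernoulli m
              ≡⟨ cong₂ (λ x y → x + - 1ℚ * y) (exp-⊛-egf bernoulli m) (one-⊛ (egf bernoulli) m) ⟨
            (exp ⊛ egf bernoulli) m + - 1ℚ * (one ⊛ egf bernoulli) m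
              ≡⟨ ⊛-linearˡ {exp-1} {exp} {one} (egf bernoulli) (- 1ℚ) (λ k →
                   solve 2 (λ x y → x :- y := x :+ con (- 1ℚ) :* y) refl (exp k) (one k)) m ⟨
            (exp-1 ⊛ egf bernoulli) m
              ≡⟨ bernoulli-egf m ⟩
            X m ∎) ⟩
        fromℕ (m !) * X m
          ≡⟨ factorial-X m ⟩
        X m ∎) ⟩
    bernoulli m + X m ∎
    where
    factorial-X : ∀ k → fromℕ (k !) * X k ≡ X k
    factorial-X zero          = refl
    factorial-X (suc zero)    = refl
    factorial-X (suc (suc k)) = *-zeroʳ (fromℕ (suc (suc k) !))

  -- Only the top terms of (x + 1)ᵐ = xᵐ + ⋯ and (x + 1)ᵐ⁺¹ = xᵐ⁺¹ + (m + 1) xᵐ + ⋯ survive.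
  translate-leading : ∀ a m → (∀ i → i < m → a i ≡ 0ℚ) →
    translate a m ≡ a m × translate a (suc m) ≡ a (suc m) + fromℕ (suc m) * a m
  translate-leading a zero    a≡0 = refl , solve 2 (λ x y → x :+ y := x :+ con 1ℚ :* y) refl (a 1) (a 0)
  translate-leading a (suc m) a≡0 with translate-leading (λ k → shift a k + a k) m
    (λ i i<m → cong₂ _+_ (a≡0 (suc i) (s<s i<m)) (a≡0 i (ℕ.m<n⇒m<1+n i<m)))
  ... | e , e′ = trans e (begin
      a (suc m) + a m  ≡⟨ cong (a (suc m) +_) aₘ ⟩
      a (suc m) + 0ℚ   ≡⟨ +-identityʳ (a (suc m)) ⟩
      a (suc m)        ∎)
    , trans e′ (begin
      a (suc (suc m)) + a (suc m) + n * (a (suc m) + a m)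
        ≡⟨ cong (λ z → a (suc (suc m)) + a (suc m) + n * (a (suc m) + z)) aₘ ⟩
      a (suc (suc m)) + a (suc m) + n * (a (suc m) + 0ℚ)
        ≡⟨ solve 3 (λ x y n → x :+ y :+ n :* (y :+ con 0ℚ) := x :+ (con 1ℚ :+ n) :* y) refl (a (suc (suc m))) (a (suc m)) n ⟩
      a (suc (suc m)) + (1ℚ + n) * a (suc m)
        ≡⟨ cong (λ z → a (suc (suc m)) + z * a (suc m)) (fromℕ-suc (suc m)) ⟨
      a (suc (suc m)) + fromℕ (suc (suc m)) * a (suc m) ∎)
    where
    n = fromℕ (suc m)
    aₘ = a≡0 m ℕ.≤-refl

  -- If `a` vanishes below `m`, invariance at xᵐ⁺¹ leaves (m + 1) `a m` = 0. For series this is the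
  -- cancellation of eᵗ - 1.
  translate-fixed⇒0 : ∀ a → translate a ≗ a → ∀ m → a m ≡ 0ℚ
  translate-fixed⇒0 a fixed = <-rec (λ m → a m ≡ 0ℚ) λ m a≡0 →
    fromℕ-*-cancelˡ (suc m) (begin
      fromℕ (suc m) * a m
        ≡⟨ solve 2 (λ x y → y := x :+ y :- x) refl (a (suc m)) (fromℕ (suc m) * a m) ⟩
      a (suc m) + fromℕ (suc m) * a m - a (suc m)
        ≡⟨ cong (_- a (suc m)) (proj₂ (translate-leading a m (λ i i<m → a≡0 i<m))) ⟨
      translate a (suc m) - a (suc m)
        ≡⟨ cong (_- a (suc m)) (fixed (suc m)) ⟩
      a (suc m) - a (suc m)
        ≡⟨ +-inverseʳ (a (suc m)) ⟩
      0ℚ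
        ≡⟨ *-zeroʳ (fromℕ (suc m)) ⟨
      fromℕ (suc m) * 0ℚ ∎)

  -- Dilation and the functional of `(2ᵐ - 1) Bₘ`

  dilate : Series → Series
  dilate a m = fromℕ (2 ℕ.^ m) * a m

  shift-dilate : ∀ a m → shift (dilate a) m ≡ dilate (shift a) m + dilate (shift a) m
  shift-dilate a m = begin
    fromℕ (2 ℕ.* 2 ℕ.^ m) * a (suc m)
      ≡⟨ cong (_* a (suc m)) (fromℕ-* 2 (2 ℕ.^ m)) ⟩
    fromℕ 2 * p * a (suc m)
      ≡⟨ solve 2 (λ p a → con (fromℕ 2) :* p :* a := p :* a :+ p :* a) refl p (a (suc m)) ⟩
    p * a (suc m) + p * a (suc m) ∎
    where p = fromℕ (2 ℕ.^ m)

  -- `dilate a` is f(x) ↦ a(f(2x)), and both sides send f to a(f(2x + 2)).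
  dilate-translate : ∀ a → dilate (translate a) ≗ translate (translate (dilate a))
  dilate-translate a zero    = refl
  dilate-translate a (suc m) = begin
    shift (dilate (translate a)) m
      ≡⟨ shift-dilate (translate a) m ⟩
    dilate (translate a⁺) m + dilate (translate a⁺) m
      ≡⟨ solve 1 (λ x → x :+ x := x :+ con 1ℚ :* x) refl (dilate (translate a⁺) m) ⟩
    dilate (translate a⁺) m + 1ℚ * dilate (translate a⁺) m
      ≡⟨ cong (λ x → x + 1ℚ * x) (dilate-translate a⁺ m) ⟩
    translate (translate (dilate a⁺)) m + 1ℚ * translate (translate (dilate a⁺)) m
      ≡⟨ translate-linear 1ℚ (translate (dilate a⁺)) (translate (dilate a⁺)) m ⟨
    translate (λ k → translate (dilate a⁺) k + 1ℚ * translate (dilate a⁺) k) m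
      ≡⟨ translate-cong (λ k → sym (translate-linear 1ℚ (dilate a⁺) (dilate a⁺) k)) m ⟩
    translate (translate (λ k → dilate a⁺ k + 1ℚ * dilate a⁺ k)) m
      ≡⟨ translate-cong (translate-cong double) m ⟩
    translate (translate (λ k → b⁺ k + 1ℚ * b k)) m
      ≡⟨ translate-cong (translate-linear 1ℚ b⁺ b) m ⟩
    translate (λ k → translate b⁺ k + 1ℚ * translate b k) m
      ≡⟨ translate-cong (λ k → solve 2 (λ x y → x :+ con 1ℚ :* y := x :+ y) refl (translate b⁺ k) (translate b k)) m ⟩
    translate (λ k → translate b⁺ k + translate b k) m ∎
    where
    a⁺ = λ k → shift a k + a k
    b = dilate a
    b⁺ = λ k → shift b k + b k
    double : ∀ k → dilate a⁺ k + 1ℚ * dilate a⁺ k ≡ b⁺ k + 1ℚ * b k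
    double k = begin
      p * (shift a k + a k) + 1ℚ * (p * (shift a k + a k))
        ≡⟨ solve 3 (λ p x y → p :* (x :+ y) :+ con 1ℚ :* (p :* (x :+ y)) := (p :* x :+ p :* x) :+ p :* y :+ con 1ℚ :* (p :* y))
             refl p (shift a k) (a k) ⟩
      dilate (shift a) k + dilate (shift a) k + b k + 1ℚ * b k
        ≡⟨ cong (λ z → z + b k + 1ℚ * b k) (shift-dilate a k) ⟨
      b⁺ k + 1ℚ * b k ∎
      where p = fromℕ (2 ℕ.^ k)

  -- The egf of (2ᵐ - 1) Bₘ is -t / (eᵗ + 1).
  genocchi : Series
  genocchi m = (fromℕ (2 ℕ.^ m) - 1ℚ) * bernoulli m

  -- Write T for `translate`. From Tβ = β + X and T²β₂ = β₂ + 2X the defect Tg + g + X of g = β₂ - β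
  -- equals Tβ₂ + β₂ - 2β, which T fixes, so it is zero. This avoids dividing by eᵗ + 1.
  translate-genocchi : ∀ m → translate genocchi m ≡ - X m - genocchi m
  translate-genocchi m = begin
    translate genocchi m
      ≡⟨ solve 3 (λ t g x → t := t :+ con 1ℚ :* g :+ con 1ℚ :* x :- (x :+ g)) refl (translate genocchi m) (genocchi m) (X m) ⟩
    residue m - (X m + genocchi m)
      ≡⟨ cong (_- (X m + genocchi m)) (translate-fixed⇒0 residue fixed m) ⟩
    0ℚ - (X m + genocchi m)
      ≡⟨ solve 2 (λ x g → con 0ℚ :- (x :+ g) := :- x :- g) refl (X m) (genocchi m) ⟩
    - X m - genocchi m ∎
    where
    β = bernoulli
    β₂ = dilate β
    residue = λ k → translate genocchi k + 1ℚ * genocchi k + 1ℚ * X k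
    genocchi-dilate : ∀ k → genocchi k ≡ β₂ k + - 1ℚ * β k
    genocchi-dilate k = solve 2 (λ p b → (p :- con 1ℚ) :* b := p :* b :+ con (- 1ℚ) :* b) refl (fromℕ (2 ℕ.^ k)) (β k)
    translate²-β₂ : ∀ k → translate (translate β₂) k ≡ β₂ k + (X k + X k)
    translate²-β₂ k = begin
      translate (translate β₂) k
        ≡⟨ dilate-translate β k ⟨
      fromℕ (2 ℕ.^ k) * translate β k
        ≡⟨ cong (fromℕ (2 ℕ.^ k) *_) (translate-bernoulli k) ⟩
      fromℕ (2 ℕ.^ k) * (β k + X k)
        ≡⟨ *-distribˡ-+ (fromℕ (2 ℕ.^ k)) (β k) (X k) ⟩
      β₂ k + fromℕ (2 ℕ.^ k) * X k
        ≡⟨ cong (β₂ k +_) (dilate-X k) ⟩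
      β₂ k + (X k + X k) ∎
      where
      dilate-X : ∀ k → dilate X k ≡ X k + X k
      dilate-X zero          = refl
      dilate-X (suc zero)    = refl
      dilate-X (suc (suc k)) = *-zeroʳ (fromℕ (2 ℕ.^ suc (suc k)))
    translate-genocchi₁ : ∀ k → translate genocchi k ≡ translate β₂ k + - 1ℚ * (β k + X k)
    translate-genocchi₁ k = begin
      translate genocchi k
        ≡⟨ translate-cong genocchi-dilate k ⟩
      translate (λ j → β₂ j + - 1ℚ * β j) k
        ≡⟨ translate-linear (- 1ℚ) β₂ β k ⟩
      translate β₂ k + - 1ℚ * translate β k
        ≡⟨ cong (λ z → translate β₂ k + - 1ℚ * z) (translate-bernoulli k) ⟩
      translate β₂ k + - 1ℚ * (β k + X k) ∎
    residue-β : ∀ k → residue k ≡ translate β₂ k + 1ℚ * (β₂ k + - (1ℚ + 1ℚ) * β k)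
    residue-β k = trans
      (cong₂ (λ t g → t + 1ℚ * g + 1ℚ * X k) (translate-genocchi₁ k) (genocchi-dilate k))
      (solve 4 (λ t b₂ b x → t :+ con (- 1ℚ) :* (b :+ x) :+ con 1ℚ :* (b₂ :+ con (- 1ℚ) :* b) :+ con 1ℚ :* x
                  := t :+ con 1ℚ :* (b₂ :+ con (- (1ℚ + 1ℚ)) :* b)) refl (translate β₂ k) (β₂ k) (β k) (X k))
    fixed : translate residue ≗ residue
    fixed k = begin
      translate residue k
        ≡⟨ translate-cong residue-β k ⟩
      translate (λ j → translate β₂ j + 1ℚ * (β₂ j + - (1ℚ + 1ℚ) * β j)) k
        ≡⟨ translate-linear 1ℚ (translate β₂) (λ j → β₂ j + - (1ℚ + 1ℚ) * β j) k ⟩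
      translate (translate β₂) k + 1ℚ * translate (λ j → β₂ j + - (1ℚ + 1ℚ) * β j) k
        ≡⟨ cong₂ (λ x y → x + 1ℚ * y) (translate²-β₂ k) (trans (translate-linear (- (1ℚ + 1ℚ)) β₂ β k)
             (cong (λ z → translate β₂ k + - (1ℚ + 1ℚ) * z) (translate-bernoulli k))) ⟩
      β₂ k + (X k + X k) + 1ℚ * (translate β₂ k + - (1ℚ + 1ℚ) * (β k + X k))
        ≡⟨ solve 4 (λ t b₂ b x → b₂ :+ (x :+ x) :+ con 1ℚ :* (t :+ con (- (1ℚ + 1ℚ)) :* (b :+ x))
                  := t :+ con 1ℚ :* (b₂ :+ con (- (1ℚ + 1ℚ)) :* b)) refl (translate β₂ k) (β₂ k) (β k) (X k) ⟩
      translate β₂ k + 1ℚ * (β₂ k + - (1ℚ + 1ℚ) * β k)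
        ≡⟨ residue-β k ⟨
      residue k ∎

  -- The moment functional on factorial bases

  square : ℕ → ℚ
  square j = fromℕ j * fromℕ j

  -- The functional f ↦ a((x - r) f).
  timesLinear : ℚ → Series → Series
  timesLinear r a m = a (suc m) - r * a m

  timesLinear-cong : ∀ r {a b} → a ≗ b → timesLinear r a ≗ timesLinear r b
  timesLinear-cong r e m = cong₂ (λ x y → x - r * y) (e (suc m)) (e m)

  -- Under x ↦ x + 1 the factor x - r becomes x - (r - 1).
  timesLinear-translate : ∀ r a → timesLinear r (translate a) ≗ translate (timesLinear (r - 1ℚ) a)
  timesLinear-translate r a m = begin
    translate (λ k → shift a k + a k) m - r * translate a m
      ≡⟨ solve 3 (λ x r y → x :- r :* y := x :+ (:- r) :* y) refl (translate (λ k → shift a k + a k) m) r (translate a m) ⟩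
    translate (λ k → shift a k + a k) m + - r * translate a m
      ≡⟨ translate-linear (- r) (λ k → shift a k + a k) a m ⟨
    translate (λ k → shift a k + a k + - r * a k) m
      ≡⟨ translate-cong (λ k → solve 3 (λ x y r → x :+ y :+ (:- r) :* y := x :- (r :- con 1ℚ) :* y) refl (a (suc k)) (a k) r) m ⟩
    translate (timesLinear (r - 1ℚ) a) m ∎

  -- The functional f ↦ a((x² - 1²) ⋯ (x² - n²) f).
  timesSquares : ℕ → Series → Series
  timesSquares zero    a m = a m
  timesSquares (suc n) a m = timesSquares n a (suc (suc m)) - square (suc n) * timesSquares n a m

  timesSquares-linear : ∀ n {a b c} r → (∀ m → a m ≡ b m + r * c m) →
    ∀ m → timesSquares n a m ≡ timesSquares n b m + r * timesSquares n c m
  timesSquares-linear zero    r e m = e m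
  timesSquares-linear (suc n) {a} {b} {c} r e m = trans
    (cong₂ (λ x y → x - square (suc n) * y) (timesSquares-linear n r e (suc (suc m))) (timesSquares-linear n r e m))
    (solve 6 (λ r q b b″ c c″ → (b″ :+ r :* c″) :- q :* (b :+ r :* c) := (b″ :- q :* b) :+ r :* (c″ :- q :* c)) refl
      r (square (suc n)) (timesSquares n b m) (timesSquares n b (suc (suc m)))
      (timesSquares n c m) (timesSquares n c (suc (suc m))))

  -- v(x) = (x - n - 1) x (x² - 1²) ⋯ (x² - n²) and v(x + 1) = (x + n + 1) x (x² - 1²) ⋯ (x² - n²),
  -- both products of 2n + 2 consecutive linear factors.
  timesLower timesUpper : ℕ → Series → Series
  timesLower n a = timesLinear (fromℕ (suc n)) (shift (timesSquares n a))
  timesUpper n a = timesLinear (- fromℕ (suc n)) (shift (timesSquares n a))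

  -- Raising `n` extends the run of consecutive factors by one at each end, here by x - n - 2 and x
  -- + n + 1, so that translation can be applied one linear factor at a time.
  timesLower-suc : ∀ n a → timesLower (suc n) a
    ≗ timesLinear (1ℚ + fromℕ (suc n)) (timesLinear (- fromℕ (suc n)) (timesLower n a))
  timesLower-suc n a m rewrite fromℕ-suc (suc n) =
    solve 5 (λ q c₁ c₂ c₃ c₄ →
        (c₄ :- q :* q :* c₂) :- (con 1ℚ :+ q) :* (c₃ :- q :* q :* c₁)
      := (c₄ :- q :* c₃ :- (:- q) :* (c₃ :- q :* c₂)) :- (con 1ℚ :+ q) :* (c₃ :- q :* c₂ :- (:- q) :* (c₂ :- q :* c₁)))
      refl (fromℕ (suc n)) (c 1) (c 2) (c 3) (c 4)
    where c = λ k → timesSquares n a (k ℕ.+ m)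

  timesUpper-suc : ∀ n a → timesUpper (suc n) a
    ≗ timesLinear (fromℕ (suc n)) (timesLinear (- (1ℚ + fromℕ (suc n))) (timesUpper n a))
  timesUpper-suc n a m rewrite fromℕ-suc (suc n) =
    solve 5 (λ q c₁ c₂ c₃ c₄ →
        (c₄ :- q :* q :* c₂) :- (:- (con 1ℚ :+ q)) :* (c₃ :- q :* q :* c₁)
      := (c₄ :- (:- q) :* c₃ :- (:- (con 1ℚ :+ q)) :* (c₃ :- (:- q) :* c₂))
           :- q :* (c₃ :- (:- q) :* c₂ :- (:- (con 1ℚ :+ q)) :* (c₂ :- (:- q) :* c₁)))
      refl (fromℕ (suc n)) (c 1) (c 2) (c 3) (c 4)
    where c = λ k → timesSquares n a (k ℕ.+ m)

  timesLower-translate : ∀ n a → timesLower n (translate a) ≗ translate (timesUpper n a)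
  timesLower-translate zero a m = trans
    (timesLinear-translate 1ℚ (λ k → shift a k + a k) m)
    (translate-cong (λ k → solve 3 (λ x y z → x :+ y :- con 0ℚ :* (y :+ z) := x :- con (- 1ℚ) :* y) refl
      (a (suc (suc k))) (a (suc k)) (a k)) m)
  timesLower-translate (suc n) a m = begin
    timesLower (suc n) (translate a) m
      ≡⟨ timesLower-suc n (translate a) m ⟩
    timesLinear (1ℚ + q) (timesLinear (- q) (timesLower n (translate a))) m
      ≡⟨ timesLinear-cong (1ℚ + q) (timesLinear-cong (- q) (timesLower-translate n a)) m ⟩
    timesLinear (1ℚ + q) (timesLinear (- q) (translate (timesUpper n a))) m
      ≡⟨ timesLinear-cong (1ℚ + q) (timesLinear-translate (- q) (timesUpper n a)) m ⟩
    timesLinear (1ℚ + q) (translate (timesLinear (- q - 1ℚ) (timesUpper n a))) m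
      ≡⟨ timesLinear-translate (1ℚ + q) (timesLinear (- q - 1ℚ) (timesUpper n a)) m ⟩
    translate (timesLinear (1ℚ + q - 1ℚ) (timesLinear (- q - 1ℚ) (timesUpper n a))) m
      ≡⟨ cong₂ (λ r s → translate (timesLinear r (timesLinear s (timesUpper n a))) m)
           (solve 1 (λ q → con 1ℚ :+ q :- con 1ℚ := q) refl q)
           (solve 1 (λ q → :- q :- con 1ℚ := :- (con 1ℚ :+ q)) refl q) ⟩
    translate (timesLinear q (timesLinear (- (1ℚ + q)) (timesUpper n a))) m
      ≡⟨ translate-cong (timesUpper-suc n a) m ⟨
    translate (timesUpper (suc n) a) m ∎
    where q = fromℕ (suc n)

  -- (-1)ᵏ k!, with the sign built into the recursion so that later identities are polynomial
  -- identities without parity cases.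
  signedFactorial : ℕ → ℚ
  signedFactorial zero    = 1ℚ
  signedFactorial (suc k) = - fromℕ (suc k) * signedFactorial k

  fromℕ-suc-! : ∀ k → fromℕ (suc k !) ≡ fromℕ (suc k) * fromℕ (k !)
  fromℕ-suc-! k = fromℕ-* (suc k) (k !)

  -- The product of the x² - j² is even, so f ↦ f′(0) sees only its constant term (-1)ⁿ n!².
  timesSquares-X : ∀ n r m → timesSquares n (λ k → r * X k) m ≡ signedFactorial n * fromℕ (n !) * (r * X m)
  timesSquares-X zero    r m = solve 1 (λ x → x := con 1ℚ :* con 1ℚ :* x) refl (r * X m)
  timesSquares-X (suc n) r m = begin
    timesSquares n (λ k → r * X k) (suc (suc m)) - q * q * timesSquares n (λ k → r * X k) m
      ≡⟨ cong₂ (λ x y → x - q * q * y) (timesSquares-X n r (suc (suc m))) (timesSquares-X n r m) ⟩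
    s * f * (r * 0ℚ) - q * q * (s * f * (r * X m))
      ≡⟨ solve 5 (λ s f r q x → s :* f :* (r :* con 0ℚ) :- q :* q :* (s :* f :* (r :* x)) := (:- q) :* s :* (q :* f) :* (r :* x))
           refl s f r q (X m) ⟩
    - q * s * (q * f) * (r * X m)
      ≡⟨ cong (λ z → - q * s * z * (r * X m)) (fromℕ-suc-! n) ⟨
    - q * s * fromℕ (suc n !) * (r * X m) ∎
    where
    q = fromℕ (suc n)
    s = signedFactorial n
    f = fromℕ (n !)

  -- From v(x) + v(x + 1) = 2 x² (x² - 1²) ⋯ (x² - n²) and genocchi(f(x) + f(x + 1)) = - f′(0).
  timesSquares-genocchi : ∀ n → timesSquares n genocchi 2 ≡ ½ * - signedFactorial (suc n) * fromℕ (n !)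
  timesSquares-genocchi n = begin
    g 2
      ≡⟨ solve 3 (λ g₂ q g₁ → g₂ := con ½ :* (g₂ :+ (g₂ :- (:- q) :* g₁) :- q :* g₁)) refl (g 2) q (g 1) ⟩
    ½ * (g 2 + timesUpper n genocchi 0 - q * g 1)
      -- At index `0` the outer `translate` acts on the constant 1 and disappears, so the value at
      -- v(x + 1) becomes the translated functional at v(x).
      ≡⟨ cong (λ z → ½ * (g 2 + z - q * g 1)) (timesLower-translate n genocchi 0) ⟨
    ½ * (g 2 + (h 2 - q * h 1) - q * g 1)
      ≡⟨ cong₂ (λ x y → ½ * (g 2 + (x - q * y) - q * g 1)) (h≡ 2) (h≡ 1) ⟩
    ½ * (g 2 + (s * f * (- 1ℚ * 0ℚ) + - 1ℚ * g 2 - q * (s * f * (- 1ℚ * 1ℚ) + - 1ℚ * g 1)) - q * g 1)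
      ≡⟨ solve 5 (λ g₁ g₂ q s f →
           con ½ :* (g₂ :+ (s :* f :* (con (- 1ℚ) :* con 0ℚ) :+ con (- 1ℚ) :* g₂
                      :- q :* (s :* f :* (con (- 1ℚ) :* con 1ℚ) :+ con (- 1ℚ) :* g₁)) :- q :* g₁)
           := con ½ :* (:- ((:- q) :* s)) :* f) refl (g 1) (g 2) q s f ⟩
    ½ * - (- q * s) * f ∎
    where
    q = fromℕ (suc n)
    s = signedFactorial n
    f = fromℕ (n !)
    g = timesSquares n genocchi
    h = timesSquares n (translate genocchi)
    h≡ : ∀ m → h m ≡ s * f * (- 1ℚ * X m) + - 1ℚ * g m
    h≡ m = trans
      (timesSquares-linear n (- 1ℚ) (λ k → trans (translate-genocchi k)
        (solve 2 (λ x y → :- x :- y := con (- 1ℚ) :* x :+ con (- 1ℚ) :* y) refl (X k) (genocchi k))) m)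
      (cong (_+ - 1ℚ * g m) (timesSquares-X n (- 1ℚ) m))

  -- As a functional on polynomials in y = x².
  moment : Series
  moment k = genocchi (2 ℕ.* k ℕ.+ 2)

  -- The functional f ↦ moment((y - 1²) ⋯ (y - n²) f).
  φ : ℕ → Series
  φ zero    = moment
  φ (suc n) = timesLinear (square (suc n)) (φ n)

  φ-timesSquares : ∀ n m → φ n m ≡ timesSquares n genocchi (2 ℕ.* m ℕ.+ 2)
  φ-timesSquares zero    m = refl
  φ-timesSquares (suc n) m = cong₂ (λ x y → x - square (suc n) * y)
    (trans (φ-timesSquares n (suc m)) (cong (λ k → timesSquares n genocchi (k ℕ.+ 2)) (ℕ.*-suc 2 m)))
    (φ-timesSquares n m)

  -- The value d(y (y - 1²) ⋯ (y - (i-1)²)).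
  newton : ℕ → Series → ℚ
  newton zero    d = d 0
  newton (suc i) d = newton i (timesLinear (square i) d)

  newton-linear : ∀ i r {a b c} → (∀ m → a m ≡ b m + r * c m) → newton i a ≡ newton i b + r * newton i c
  newton-linear zero    r e = e 0
  newton-linear (suc i) r {a} {b} {c} e = newton-linear i r λ m → trans
    (cong₂ (λ x y → x - square i * y) (e (suc m)) (e m))
    (solve 6 (λ r q b b′ c c′ → (b′ :+ r :* c′) :- q :* (b :+ r :* c) := (b′ :- q :* b) :+ r :* (c′ :- q :* c)) refl
      r (square i) (b m) (b (suc m)) (c m) (c (suc m)))

  -- The test polynomial ρₖ is monic of degree k, so only yᵏ contributes.
  newton-leading : ∀ k d → (∀ i → i < k → d i ≡ 0ℚ) → newton k d ≡ d k
  newton-leading zero    d d≡0 = refl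
  newton-leading (suc k) d d≡0 = begin
    newton k (timesLinear (square k) d)
      ≡⟨ newton-leading k (timesLinear (square k) d) (λ i i<k →
           trans (cong₂ (λ x y → x - square k * y) (d≡0 (suc i) (s<s i<k)) (d≡0 i (ℕ.m<n⇒m<1+n i<k)))
                 (solve 1 (λ q → con 0ℚ :- q :* con 0ℚ := con 0ℚ) refl (square k))) ⟩
    d (suc k) - square k * d k
      ≡⟨ cong (λ x → d (suc k) - square k * x) (d≡0 k ℕ.≤-refl) ⟩
    d (suc k) - square k * 0ℚ
      ≡⟨ solve 2 (λ x q → x :- q :* con 0ℚ := x) refl (d (suc k)) (square k) ⟩
    d (suc k) ∎

  newton-vanishing : ∀ k d → (∀ i → i < k → newton i d ≡ 0ℚ) → ∀ i → i < k → d i ≡ 0ℚ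
  newton-vanishing k d newton≡0 = <-rec (λ i → i < k → d i ≡ 0ℚ) λ i below i<k →
    trans (sym (newton-leading i d λ j j<i → below j<i (ℕ.<-trans j<i i<k))) (newton≡0 i i<k)

  -- Split y - i² = (y - (k + 1)²) + ((k + 1)² - i²). The first part turns φₖ into φₖ₊₁, and (k +
  -- 1)² - i² contains the factor i + k + 1 common to both terms; what remains is -(k + 2) + (k + 1
  -- - i) = -(i + 1).
  newton-φ : ∀ i k → newton i (φ k) ≡ ½ * - signedFactorial (suc k) * signedFactorial i * fromℕ ((i ℕ.+ k) !)
  newton-φ zero    k = trans (φ-timesSquares k 0) (trans (timesSquares-genocchi k)
    (solve 2 (λ s f → con ½ :* (:- s) :* f := con ½ :* (:- s) :* con 1ℚ :* f) refl (signedFactorial (suc k)) (fromℕ (k !))))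
  newton-φ (suc i) k = begin
    newton i (timesLinear (square i) (φ k))
      ≡⟨ newton-linear i (square (suc k) - square i) (λ m →
           solve 4 (λ x y p q → x :- p :* y := x :- q :* y :+ (q :- p) :* y) refl (φ k (suc m)) (φ k m) (square i) (square (suc k))) ⟩
    newton i (φ (suc k)) + (square (suc k) - square i) * newton i (φ k)
      ≡⟨ cong₂ (λ x y → x + (square (suc k) - square i) * y) (newton-φ i (suc k)) (newton-φ i k) ⟩
    ½ * - (- fromℕ (suc (suc k)) * s) * t * fromℕ ((i ℕ.+ suc k) !)
      + (square (suc k) - square i) * (½ * - s * t * fromℕ ((i ℕ.+ k) !))
      ≡⟨ cong₂ (λ l₂ g → ½ * - (- l₂ * s) * t * g + (square (suc k) - square i) * (½ * - s * t * f))
           (trans (fromℕ-suc (suc k)) (cong (1ℚ +_) (fromℕ-suc k)))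
           (trans (cong (λ j → fromℕ (j !)) (ℕ.+-suc i k)) next) ⟩
    ½ * - (- (1ℚ + (1ℚ + l)) * s) * t * ((1ℚ + (j + l)) * f) + (square (suc k) - square i) * (½ * - s * t * f)
      ≡⟨ cong (λ l₁ → ½ * - (- (1ℚ + (1ℚ + l)) * s) * t * ((1ℚ + (j + l)) * f) + (l₁ * l₁ - square i) * (½ * - s * t * f))
           (fromℕ-suc k) ⟩
    ½ * - (- (1ℚ + (1ℚ + l)) * s) * t * ((1ℚ + (j + l)) * f) + ((1ℚ + l) * (1ℚ + l) - j * j) * (½ * - s * t * f)
      ≡⟨ solve 5 (λ j l s t f →
           con ½ :* (:- ((:- (con 1ℚ :+ (con 1ℚ :+ l))) :* s)) :* t :* ((con 1ℚ :+ (j :+ l)) :* f)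
             :+ ((con 1ℚ :+ l) :* (con 1ℚ :+ l) :- j :* j) :* (con ½ :* (:- s) :* t :* f)
           := con ½ :* (:- s) :* ((:- (con 1ℚ :+ j)) :* t) :* ((con 1ℚ :+ (j :+ l)) :* f)) refl j l s t f ⟩
    ½ * - s * (- (1ℚ + j) * t) * ((1ℚ + (j + l)) * f)
      ≡⟨ cong₂ (λ x y → ½ * - s * (- x * t) * y) (fromℕ-suc i) next ⟨
    ½ * - s * (- fromℕ (suc i) * t) * fromℕ (suc (i ℕ.+ k) !) ∎
    where
    j = fromℕ i
    l = fromℕ k
    s = signedFactorial (suc k)
    t = signedFactorial i
    f = fromℕ ((i ℕ.+ k) !)
    next : fromℕ (suc (i ℕ.+ k) !) ≡ (1ℚ + (j + l)) * f
    next = trans (fromℕ-suc-! (i ℕ.+ k))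
      (cong (_* f) (trans (fromℕ-suc (i ℕ.+ k)) (cong (1ℚ +_) (fromℕ-+ i k))))

  -- Orthogonal polynomials of the moment functional

  falling : ℕ → ℕ → ℚ
  falling i zero    = 1ℚ
  falling i (suc s) = falling i s * (fromℕ i - fromℕ s)

  falling-zero : ∀ i s → i < s → falling i s ≡ 0ℚ
  falling-zero i (suc s) i<s with ℕ.m<1+n⇒m<n∨m≡n i<s
  ... | inj₁ i<s′ = trans (cong (_* (fromℕ i - fromℕ s)) (falling-zero i s i<s′)) (*-zeroˡ (fromℕ i - fromℕ s))
  ... | inj₂ refl = trans (cong (falling i s *_) (+-inverseʳ (fromℕ i))) (*-zeroʳ (falling i s))

  falling-suc-suc : ∀ i s → falling (suc i) (suc s) ≡ fromℕ (suc i) * falling i s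
  falling-suc-suc i zero    = solve 1 (λ q → con 1ℚ :* (q :- con 0ℚ) := q :* con 1ℚ) refl (fromℕ (suc i))
  falling-suc-suc i (suc s) = begin
    falling (suc i) (suc s) * (fromℕ (suc i) - fromℕ (suc s))
      ≡⟨ cong₂ (λ x y → x * y) (falling-suc-suc i s) (cong₂ _-_ (fromℕ-suc i) (fromℕ-suc s)) ⟩
    fromℕ (suc i) * falling i s * (1ℚ + fromℕ i - (1ℚ + fromℕ s))
      ≡⟨ solve 4 (λ q f i s → q :* f :* (con 1ℚ :+ i :- (con 1ℚ :+ s)) := q :* (f :* (i :- s))) refl
           (fromℕ (suc i)) (falling i s) (fromℕ i) (fromℕ s) ⟩
    fromℕ (suc i) * (falling i s * (fromℕ i - fromℕ s)) ∎

  falling-diagonal : ∀ k → falling k k ≡ fromℕ (k !)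
  falling-diagonal zero    = refl
  falling-diagonal (suc k) = trans (falling-suc-suc k k)
    (trans (cong (fromℕ (suc k) *_) (falling-diagonal k)) (sym (fromℕ-suc-! k)))

  -- The factor s + m + 2 matches the growth of `signedFactorial` from one column to the next; the
  -- factor s + m + 1 is subtracted from the i + m + 1 coming from the factorial and leaves i - s,
  -- the next factor of `falling i`.
  orthogonaliser : ℕ → ℕ → ℚ
  orthogonaliser s m = fromℕ (suc (s ℕ.+ m)) * fromℕ (suc (suc (s ℕ.+ m)))

  -- Only the factor (i + m)! of newton i (φ m) couples i and m, so turning it into one
  -- that vanishes for i < m triangularises the matrix.
  orthogonal : ℕ → ℕ → Series
  orthogonal zero    m   = φ m
  orthogonal (suc s) m i = orthogonal s (suc m) i + orthogonaliser s m * orthogonal s m i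

  newton-orthogonal : ∀ s m i → newton i (orthogonal s m)
    ≡ ½ * - signedFactorial (suc (s ℕ.+ m)) * signedFactorial i * (fromℕ ((i ℕ.+ m) !) * falling i s)
  newton-orthogonal zero    m i = trans (newton-φ i m)
    (cong (½ * - signedFactorial (suc m) * signedFactorial i *_) (sym (*-identityʳ (fromℕ ((i ℕ.+ m) !)))))
  newton-orthogonal (suc s) m i = begin
    newton i (orthogonal (suc s) m)
      ≡⟨ newton-linear i (n₁ * n₂) (λ _ → refl) ⟩
    newton i (orthogonal s (suc m)) + n₁ * n₂ * newton i (orthogonal s m)
      ≡⟨ cong₂ (λ x y → x + n₁ * n₂ * y) (newton-orthogonal s (suc m) i) (newton-orthogonal s m i) ⟩
    ½ * - signedFactorial (suc (s ℕ.+ suc m)) * t * (fromℕ ((i ℕ.+ suc m) !) * c) + n₁ * n₂ * (½ * - u * t * (f * c))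
      ≡⟨ cong₂ (λ x y → ½ * - signedFactorial (suc x) * t * (fromℕ (y !) * c) + n₁ * n₂ * (½ * - u * t * (f * c)))
           (ℕ.+-suc s m) (ℕ.+-suc i m) ⟩
    ½ * - (- n₂ * u) * t * (fromℕ (suc (i ℕ.+ m) !) * c) + n₁ * n₂ * (½ * - u * t * (f * c))
      ≡⟨ cong₂ (λ x y → ½ * - (- n₂ * u) * t * (x * c) + y * n₂ * (½ * - u * t * (f * c)))
           (trans (fromℕ-suc-! (i ℕ.+ m)) (cong (_* f) (trans (fromℕ-suc (i ℕ.+ m)) (cong (1ℚ +_) (fromℕ-+ i m)))))
           (trans (fromℕ-suc (s ℕ.+ m)) (cong (1ℚ +_) (fromℕ-+ s m))) ⟩
    ½ * - (- n₂ * u) * t * ((1ℚ + (j + l)) * f * c) + (1ℚ + (r + l)) * n₂ * (½ * - u * t * (f * c))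
      ≡⟨ solve 8 (λ j l r n u t f c →
           con ½ :* (:- ((:- n) :* u)) :* t :* ((con 1ℚ :+ (j :+ l)) :* f :* c)
             :+ (con 1ℚ :+ (r :+ l)) :* n :* (con ½ :* (:- u) :* t :* (f :* c))
           := con ½ :* (:- ((:- n) :* u)) :* t :* (f :* (c :* (j :- r)))) refl j l r n₂ u t f c ⟩
    ½ * - (- n₂ * u) * t * (f * (c * (j - r))) ∎
    where
    n₁ = fromℕ (suc (s ℕ.+ m))
    n₂ = fromℕ (suc (suc (s ℕ.+ m)))
    u = signedFactorial (suc (s ℕ.+ m))
    t = signedFactorial i
    c = falling i s
    f = fromℕ ((i ℕ.+ m) !)
    j = fromℕ i
    l = fromℕ m
    r = fromℕ s

  orthogonal-upper : ∀ k i → i < k → orthogonal k 0 i ≡ 0ℚ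
  orthogonal-upper k = newton-vanishing k (orthogonal k 0) λ i i<k → begin
    newton i (orthogonal k 0)
      ≡⟨ newton-orthogonal k 0 i ⟩
    v i * (fromℕ ((i ℕ.+ 0) !) * falling i k)
      ≡⟨ cong (λ z → v i * (fromℕ ((i ℕ.+ 0) !) * z)) (falling-zero i k i<k) ⟩
    v i * (fromℕ ((i ℕ.+ 0) !) * 0ℚ)
      ≡⟨ solve 2 (λ x y → x :* (y :* con 0ℚ) := con 0ℚ) refl (v i) (fromℕ ((i ℕ.+ 0) !)) ⟩
    0ℚ ∎
    where v = λ i → ½ * - signedFactorial (suc (k ℕ.+ 0)) * signedFactorial i

  signedFactorial² : ∀ k → signedFactorial k * signedFactorial k ≡ fromℕ (k !) * fromℕ (k !)
  signedFactorial² zero    = refl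
  signedFactorial² (suc k) = begin
    - q * s * (- q * s)
      ≡⟨ solve 2 (λ q s → (:- q) :* s :* ((:- q) :* s) := q :* q :* (s :* s)) refl q s ⟩
    q * q * (s * s)
      ≡⟨ cong (q * q *_) (signedFactorial² k) ⟩
    q * q * (f * f)
      ≡⟨ solve 2 (λ q f → q :* q :* (f :* f) := q :* f :* (q :* f)) refl q f ⟩
    q * f * (q * f)
      ≡⟨ cong (λ z → z * z) (fromℕ-suc-! k) ⟨
    fromℕ (suc k !) * fromℕ (suc k !) ∎
    where
    q = fromℕ (suc k)
    s = signedFactorial k
    f = fromℕ (k !)

  fromℕ-^4 : ∀ n → fromℕ (n ℕ.^ 4) ≡ fromℕ n * fromℕ n * (fromℕ n * fromℕ n)
  fromℕ-^4 n = begin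
    fromℕ (n ℕ.^ 4)
      ≡⟨ cong fromℕ (ℕ.^-distribˡ-+-* n 2 2) ⟩
    fromℕ (n ℕ.^ 2 ℕ.* n ℕ.^ 2)
      ≡⟨ fromℕ-* (n ℕ.^ 2) (n ℕ.^ 2) ⟩
    fromℕ (n ℕ.^ 2) * fromℕ (n ℕ.^ 2)
      ≡⟨ cong (λ z → z * z) (trans (fromℕ-* n (n ℕ.* 1)) (cong (λ m → fromℕ n * fromℕ m) (ℕ.*-identityʳ n))) ⟩
    fromℕ n * fromℕ n * (fromℕ n * fromℕ n) ∎

  -- Two of the four factorials are `signedFactorial k` squared, which removes the signs; the others
  -- are (k + 0)! and `falling k k`.
  orthogonal-diagonal : ∀ k → orthogonal k 0 k ≡ ½ * fromℕ (suc k ℕ.* (k !) ℕ.^ 4)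
  orthogonal-diagonal k = begin
    orthogonal k 0 k
      ≡⟨ newton-leading k (orthogonal k 0) (orthogonal-upper k) ⟨
    newton k (orthogonal k 0)
      ≡⟨ newton-orthogonal k 0 k ⟩
    ½ * - signedFactorial (suc (k ℕ.+ 0)) * s * (fromℕ ((k ℕ.+ 0) !) * falling k k)
      ≡⟨ cong₂ (λ x y → ½ * - signedFactorial (suc x) * s * (fromℕ (x !) * y)) (ℕ.+-identityʳ k) (falling-diagonal k) ⟩
    ½ * - (- q * s) * s * (f * f)
      ≡⟨ solve 3 (λ q s f → con ½ :* (:- ((:- q) :* s)) :* s :* (f :* f) := con ½ :* (q :* (s :* s :* (f :* f)))) refl q s f ⟩
    ½ * (q * (s * s * (f * f)))
      ≡⟨ cong (λ z → ½ * (q * (z * (f * f)))) (signedFactorial² k) ⟩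
    ½ * (q * (f * f * (f * f)))
      ≡⟨ cong (λ z → ½ * (q * z)) (fromℕ-^4 (k !)) ⟨
    ½ * (q * fromℕ ((k !) ℕ.^ 4))
      ≡⟨ cong (½ *_) (fromℕ-* (suc k) ((k !) ℕ.^ 4)) ⟨
    ½ * fromℕ (suc k ℕ.* (k !) ℕ.^ 4) ∎
    where
    q = fromℕ (suc k)
    s = signedFactorial k
    f = fromℕ (k !)

  -- Evaluation of the Hankel determinant

  hankelDet-moment : ∀ n → hankelDet n moment ≡ ∏< (suc n) (λ k → ½ * fromℕ (suc k ℕ.* (k !) ℕ.^ 4))
  hankelDet-moment n = begin
    hankelDet n moment
      ≡⟨ det-cong {suc n} (λ i j → cong moment (ℕ.+-comm (toℕ i) (toℕ j))) ⟩
    columnDet (suc n) (λ j i → moment (j ℕ.+ i))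
      -- Entry (s, m) of the array is the column of values L(yⁱ yᵐ φₛ), and yᵐ φₛ₊₁ = yᵐ⁺¹ φₛ - (s +
      -- 1)² yᵐ φₛ; its entries with m = 0 are the columns `φ k`.
      ≡⟨ columnDet-elimination (suc n) (λ s _ → - square (suc s)) (λ s m i → φ s (m ℕ.+ i)) (λ s m i →
           solve 3 (λ x y q → x :- q :* y := x :+ (:- q) :* y) refl (φ s (suc (m ℕ.+ i))) (φ s (m ℕ.+ i)) (square (suc s))) ⟩
    columnDet (suc n) φ
      ≡⟨ columnDet-elimination (suc n) orthogonaliser orthogonal (λ _ _ _ → refl) ⟩
    columnDet (suc n) (λ k → orthogonal k 0)
      ≡⟨ columnDet-triangular (suc n) (λ k → orthogonal k 0) orthogonal-upper ⟩
    ∏< (suc n) (λ k → orthogonal k 0 k)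
      ≡⟨ ∏<-cong (suc n) orthogonal-diagonal ⟩
    ∏< (suc n) (λ k → ½ * fromℕ (suc k ℕ.* (k !) ℕ.^ 4)) ∎
    where
    ∏<-cong : ∀ n {f g : ℕ → ℚ} → f ≗ g → ∏< n f ≡ ∏< n g
    ∏<-cong zero    e = refl
    ∏<-cong (suc n) e = cong₂ _*_ (e 0) (∏<-cong n (e ∘ suc))

  ∏<-½ : ∀ n u → fromℕ (2 ℕ.^ n) * ∏< n (λ k → ½ * fromℕ (u k)) ≡ fromℕ (product (applyUpTo u n))
  ∏<-½ zero    u = refl
  ∏<-½ (suc n) u = begin
    fromℕ (2 ℕ.* 2 ℕ.^ n) * (½ * fromℕ (u 0) * p)
      ≡⟨ cong (_* (½ * fromℕ (u 0) * p)) (fromℕ-* 2 (2 ℕ.^ n)) ⟩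
    fromℕ 2 * fromℕ (2 ℕ.^ n) * (½ * fromℕ (u 0) * p)
      ≡⟨ solve 3 (λ m a p → con (fromℕ 2) :* m :* (con ½ :* a :* p) := a :* (m :* p)) refl (fromℕ (2 ℕ.^ n)) (fromℕ (u 0)) p ⟩
    fromℕ (u 0) * (fromℕ (2 ℕ.^ n) * p)
      ≡⟨ cong (fromℕ (u 0) *_) (∏<-½ n (u ∘ suc)) ⟩
    fromℕ (u 0) * fromℕ (product (applyUpTo (u ∘ suc) n))
      ≡⟨ fromℕ-* (u 0) (product (applyUpTo (u ∘ suc) n)) ⟨
    fromℕ (product (applyUpTo u (suc n))) ∎
    where p = ∏< n (λ k → ½ * fromℕ (u (suc k)))

  product-applyUpTo-* : ∀ (u v : ℕ → ℕ) n →
    product (applyUpTo (λ k → u k ℕ.* v k) n) ≡ product (applyUpTo u n) ℕ.* product (applyUpTo v n)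
  product-applyUpTo-* u v zero    = refl
  product-applyUpTo-* u v (suc n) = trans
    (cong (u 0 ℕ.* v 0 ℕ.*_) (product-applyUpTo-* (u ∘ suc) (v ∘ suc) n))
    (ℕ.[m*n]*[o*p]≡[m*o]*[n*p] (u 0) (v 0) _ _)

  product-applyUpTo-suc : ∀ n → product (applyUpTo suc n) ≡ n !
  product-applyUpTo-suc zero    = refl
  product-applyUpTo-suc (suc n) = begin
    product (applyUpTo suc (suc n))
      ≡⟨ cong product (applyUpTo-∷ʳ suc n) ⟨
    product (applyUpTo suc n ∷ʳ suc n)
      ≡⟨ product-++ (applyUpTo suc n) [ suc n ] ⟩
    product (applyUpTo suc n) ℕ.* (suc n ℕ.* 1)
      ≡⟨ cong₂ ℕ._*_ (product-applyUpTo-suc n) (ℕ.*-identityʳ (suc n)) ⟩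
    n ! ℕ.* suc n
      ≡⟨ ℕ.*-comm (n !) (suc n) ⟩
    suc n ! ∎

  hankelDet-moment-product : ∀ n → fromℕ (2 ℕ.^ suc n) * hankelDet n moment
    ≡ fromℕ (suc n !) * fromℕ (product (applyUpTo (λ i → (suc i !) ℕ.^ 4) n))
  hankelDet-moment-product n = begin
    fromℕ (2 ℕ.^ suc n) * hankelDet n moment
      ≡⟨ cong (fromℕ (2 ℕ.^ suc n) *_) (hankelDet-moment n) ⟩
    fromℕ (2 ℕ.^ suc n) * ∏< (suc n) (λ k → ½ * fromℕ (suc k ℕ.* (k !) ℕ.^ 4))
      ≡⟨ ∏<-½ (suc n) (λ k → suc k ℕ.* (k !) ℕ.^ 4) ⟩
    fromℕ (product (applyUpTo (λ k → suc k ℕ.* (k !) ℕ.^ 4) (suc n)))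
      ≡⟨ cong fromℕ (product-applyUpTo-* suc (λ k → (k !) ℕ.^ 4) (suc n)) ⟩
    fromℕ (product (applyUpTo suc (suc n)) ℕ.* (1 ℕ.* p))
      -- The leading `1` is the factor 0!⁴; dropping it makes the product start at ℓ = 1.
      ≡⟨ cong fromℕ (cong₂ ℕ._*_ (product-applyUpTo-suc (suc n)) (ℕ.*-identityˡ p)) ⟩
    fromℕ (suc n ! ℕ.* p)
      ≡⟨ fromℕ-* (suc n !) p ⟩
    fromℕ (suc n !) * fromℕ p ∎
    where p = product (applyUpTo (λ i → (suc i !) ℕ.^ 4) n)

open import Data.Integer.Base using (+_)
open import Data.List.Base using (applyUpTo)
import Data.Nat.Base as ℕ
open import Data.Nat.Base using (ℕ; suc; _+_; _^_; _!)
open import Data.Nat.ListAction using (product)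
open import Data.Nat.Properties using (m^n≢0; +-comm)
open import Data.Rational.Base using (1ℚ; _*_; _-_; _/_)
open import Data.Rational.Properties using (*-assoc; *-comm)
open import Relation.Binary.PropositionalEquality using (_≡_; cong; module ≡-Reasoning)
open HankelMoments using (moment; hankelDet-moment-product; /-fromℕ; fromℕ-*-cancelˡ)

corollary5p3 : ∀ (n : ℕ) →
    hankelDet n (λ k → (fromℕ (2 ^ (2 ℕ.* k + 2)) - 1ℚ) * bernoulli (2 ℕ.* k + 2))
    ≡ (+ ((n + 1) !) / (2 ^ (n + 1))) {{m^n≢0 2 (n + 1)}}
    * fromℕ (product (applyUpTo (λ i → (suc i !) ^ 4) n))
corollary5p3 n = fromℕ-*-cancelˡ d (begin
  -- The sequence in the statement is `moment` by definition; multiplying by 2ⁿ⁺¹ clears the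
  -- denominator.
  fromℕ d * hankelDet n moment
    ≡⟨ cong (λ m → fromℕ (2 ^ m) * hankelDet n moment) (+-comm n 1) ⟩
  fromℕ (2 ^ suc n) * hankelDet n moment
    ≡⟨ hankelDet-moment-product n ⟩
  fromℕ (suc n !) * p
    ≡⟨ cong (λ m → fromℕ (m !) * p) (+-comm n 1) ⟨
  fromℕ ((n + 1) !) * p
    ≡⟨ cong (_* p) (/-fromℕ ((n + 1) !) d) ⟨
  q * fromℕ d * p
    ≡⟨ cong (_* p) (*-comm q (fromℕ d)) ⟩
  fromℕ d * q * p
    ≡⟨ *-assoc (fromℕ d) q p ⟩
  fromℕ d * (q * p) ∎)
  where
  open ≡-Reasoning
  d = 2 ^ (n + 1)
  instance
    d≢0 : ℕ.NonZero d
    d≢0 = m^n≢0 2 (n + 1)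
  q = + ((n + 1) !) / d
  p = fromℕ (product (applyUpTo (λ i → (suc i !) ^ 4) n))
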